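{- For all nonnegative integers $n$, we have $b_{3,3}(n)\geq b_{2,3}(n)$.
   Context: A partition of a positive integer $n$ is a finite non-increasing sequence of positive integers $\lambda=(\lambda_1,\lambda_2,\ldots,\lambda_r)$ with $\lambda_1+\cdots+\lambda_r=n$; for $n=0$ the only partition is the empty one, whose Young diagram has no boxes. The Young diagram of $\lambda$ is the left-justified array of boxes whose $i$-th row from the top has $\lambda_i$ boxes. The hook length of a box in a Young diagram is the number of boxes directly to its right (in the same row) plus the number of boxes directly below it (in the same column) plus $1$ (for the box itself). For an integer $t\geq 2$, a $t$-regular partition of $n$ is a partition of $n$ none of whose parts is divisible by $t$. For integers $t\geq 2$ and $k\geq 1$, $b_{t,k}(n)$ denotes the number of hooks of length $k$ in all the $t$-regular partitions of $n$, i.e. the sum over all $t$-regular partitions $\lambda$ of $n$ of the number of boxes in the Young diagram of $\lambda$ with hook length equal to $k$. -}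

module Defs where

open import Data.List.Base using (List; []; _∷_; _++_; cartesianProductWith; filter; length; map; upTo)
open import Data.List.Membership.Propositional using (_∈_)
open import Data.List.Membership.Propositional.Properties
  using (∈-cartesianProductWith⁺; ∈-filter⁺; ∈-filter⁻; ∈-upTo⁺)
open import Data.List.Relation.Unary.All using (All; []; _∷_; all?)
open import Data.List.Relation.Unary.AllPairs using ([]; _∷_)
open import Data.List.Relation.Unary.Any using (here; there)
open import Data.List.Relation.Unary.Linked using (Linked; linked?)
open import Data.List.Relation.Unary.Unique.Propositional using (Unique)
import Data.List.Relation.Unary.All.Properties as All
import Data.List.Relation.Unary.Unique.Propositional.Properties as Unique
open import Data.Nat.Base using (ℕ; zero; suc; _+_; _≤_; _<_; _≥_; z≤n; s≤s)
open import Data.Nat.Divisibility using (_∤_; _∣?_)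
open import Data.Nat.ListAction using (sum)
open import Data.Nat.Properties
  using (_≟_; _<?_; _≥?_; ≤-trans; ≤-reflexive; +-mono-≤; m≤m+n; m≤n+m)
open import Data.Product.Base using (_×_; _,_; proj₂; map₁)
open import Function.Bundles using (_⇔_; mk⇔)
open import Relation.Binary.PropositionalEquality using (_≡_; refl; setoid)
open import Relation.Nullary.Decidable using (_×-dec_; ¬?)
open import Relation.Unary using (Decidable)

IsPartition : ℕ → List ℕ → Set
IsPartition n μ = Linked _≥_ μ × All (0 <_) μ × sum μ ≡ n

isPartition? : ∀ n → Decidable (IsPartition n)
isPartition? n μ = linked? _≥?_ μ ×-dec all? (0 <?_) μ ×-dec (sum μ ≟ n)

-- All lists of length at most ℓ with entries in {1,…,m}, without repetition.
candidates : ℕ → ℕ → List (List ℕ)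
candidates m zero    = [] ∷ []
candidates m (suc ℓ) =
  [] ∷ cartesianProductWith (λ i μ → suc i ∷ μ) (upTo m) (candidates m ℓ)

-- A partition of n has at most n parts, each at most n, so filtering the
-- candidates loses none; ∈-partitions and partitions-unique below show that
-- every partition of n is listed exactly once.
partitions : ℕ → List (List ℕ)
partitions n = filter (isPartition? n) (candidates n n)

Regular : ℕ → List ℕ → Set
Regular t = All (t ∤_)

regular? : ∀ t → Decidable (Regular t)
regular? t = all? (λ p → ¬? (t ∣? p))

-- The box (i , j) lies in row i from the top and column j from the left,
-- both counted from 0.
Box : Set
Box = ℕ × ℕ

youngDiagram : List ℕ → List Box
youngDiagram []      = []
youngDiagram (r ∷ μ) = map (0 ,_) (upTo r) ++ map (map₁ suc) (youngDiagram μ)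

boxesRight : List Box → Box → List Box
boxesRight D (i , j) = filter (λ (i′ , j′) → (i′ ≟ i) ×-dec (j <? j′)) D

boxesBelow : List Box → Box → List Box
boxesBelow D (i , j) = filter (λ (i′ , j′) → (i <? i′) ×-dec (j′ ≟ j)) D

hookLength : List Box → Box → ℕ
hookLength D x = length (boxesRight D x) + length (boxesBelow D x) + 1

hooks : ℕ → List ℕ → ℕ
hooks k μ = length (filter (λ x → hookLength D x ≟ k) D)
  where D = youngDiagram μ

-- b t k n is b_{t,k}(n); only t ≥ 2 and k ≥ 1 are meaningful.
b : ℕ → ℕ → ℕ → ℕ
b t k n = sum (map (hooks k) (filter (regular? t) (partitions n)))

private
  ∈-candidates : ∀ m ℓ μ → length μ ≤ ℓ → All (0 <_) μ → All (_≤ m) μ →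
                 μ ∈ candidates m ℓ
  ∈-candidates m zero    []          _       _        _        = here refl
  ∈-candidates m (suc ℓ) []          _       _        _        = here refl
  ∈-candidates m (suc ℓ) (suc i ∷ μ) (s≤s l) (_ ∷ ps) (q ∷ qs) =
    there (∈-cartesianProductWith⁺ (λ i μ → suc i ∷ μ)
            (∈-upTo⁺ q) (∈-candidates m ℓ μ l ps qs))

  length≤sum : ∀ μ → All (0 <_) μ → length μ ≤ sum μ
  length≤sum []      []       = z≤n
  length≤sum (p ∷ μ) (q ∷ qs) = +-mono-≤ q (length≤sum μ qs)

  parts≤ : ∀ {n} μ → sum μ ≤ n → All (_≤ n) μ
  parts≤ []      _ = []
  parts≤ (p ∷ μ) h =
    ≤-trans (m≤m+n p (sum μ)) h ∷ parts≤ μ (≤-trans (m≤n+m (sum μ) p) h)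

  candidates-unique : ∀ m ℓ → Unique (candidates m ℓ)
  candidates-unique m zero    = [] ∷ []
  candidates-unique m (suc ℓ) =
    All.cartesianProductWith⁺ (setoid ℕ) (setoid (List ℕ)) _ (upTo m) (candidates m ℓ)
      (λ _ _ ())
    ∷ Unique.cartesianProductWith⁺ _ inj (Unique.upTo⁺ m) (candidates-unique m ℓ)
    where
    inj : ∀ {i j} {μ ν : List ℕ} → suc i ∷ μ ≡ suc j ∷ ν → i ≡ j × μ ≡ ν
    inj refl = refl , refl

∈-partitions : ∀ {n μ} → μ ∈ partitions n ⇔ IsPartition n μ
∈-partitions {n} {μ} = mk⇔
  (λ μ∈ → proj₂ (∈-filter⁻ (isPartition? n) {xs = candidates n n} μ∈))
  complete
  where
  complete : IsPartition n μ → μ ∈ partitions n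
  complete p@(_ , pos , refl) = ∈-filter⁺ (isPartition? n)
    (∈-candidates n n μ (length≤sum μ pos) pos (parts≤ μ (≤-reflexive refl))) p

partitions-unique : ∀ n → Unique (partitions n)
partitions-unique n = Unique.filter⁺ (isPartition? n) (candidates-unique n n)

{-# OPTIONS --safe #-}
module Submission where

-- The first row of a partition p ∷ μ with p ≥ 3 contains one hook of length 3 for
-- each of the following that holds: μ has exactly 2 parts ≥ p, exactly 1 part
-- ≥ p − 1, no part ≥ p − 2.  Summing over partitions,
-- Σ b_{t,3}(n) q^n = P_t F_t, where P_t is the generating function of t-regular
-- partitions and F_t is a rational function.  Write u m = 1/(1 − q^m).
-- The parts prime to 6 contribute a factor u 1 · a to both P_3 and P_2; the
-- others contribute u 2 · u 4 · e and u 3 · o, and u 1 · (e − o) has nonnegative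
-- coefficients because u 1 · (u m − u (m + 1)) does.  Hence
--   P_3 F_3 − P_2 F_2 = a · (u 1 · (e − o) · M + o · G)
-- with M = u 2 · u 4 · F_3 and G = u 1 · (M − u 3 · F_2), two explicit rational
-- functions that have nonnegative coefficients.

-- Signs are the obstacle. Neither `e − o` nor `M − u 3 · F_2` is nonnegative: for `e = u 8 · u 10`
-- and `o = u 9` the former has coefficient -1 at q^9, and the latter has -2 at q^6. Both are
-- repaired by the factor `u 1` of the part 1; as they stand in different summands, this one factor
-- serves both. F_t is rational for this reason: after division by P_t, each block of t consecutive
-- parts contributes a cubic in z = q^(k t), and the cubics add up to geometric series in q^t,
-- q^(2t) and q^(3t). Infinite products never occur. Parts are bounded by 6 + 6n, and what is then
-- missing from F_t is divisible by a power of q beyond q^n.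

open import Defs
open import Data.Nat using (ℕ; _≥_)
open import Algebra.Bundles using (CommutativeRing)
import Algebra.Properties.Semiring.Exp as Exp
open import Algebra.Solver.Ring.AlmostCommutativeRing
  using (fromCommutativeRing; _-Raw-AlmostCommutative⟶_)
import Algebra.Solver.Ring as RingSolver
open import Algebra.Structures using (IsCommutativeRing)
open import Data.Bool.Base using (true; false; if_then_else_)
open import Data.Integer.Base as ℤ using (ℤ; 0ℤ; 1ℤ) renaming (+_ to pos)
import Data.Integer.Properties as ℤ
open import Data.Integer.Tactic.RingSolver using (solve-∀)
open import Data.List.Base using (List; []; _∷_; _++_; _∷ʳ_; filter; length; map; upTo)
open import Data.List.Membership.Propositional using (_∈_)
open import Data.List.Membership.Propositional.Properties
  using (∈-filter⁺; ∈-filter⁻; ∈-++⁺ˡ; ∈-++⁺ʳ; ∈-++⁻; ∈-map⁺; ∈-map⁻)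
open import Data.List.Membership.Propositional.Properties.WithK using (unique∧set⇒bag)
open import Data.List.Properties
  using (++-assoc; filter-++; filter-all; filter-none; length-++; length-upTo;
         map-++; map-∘; map-upTo; upTo-∷ʳ)
open import Data.List.Relation.Binary.BagAndSetEquality using (∼bag⇒↭)
open import Data.List.Relation.Binary.Permutation.Propositional using (_↭_)
open import Data.List.Relation.Binary.Permutation.Propositional.Properties using (map⁺)
open import Data.List.Relation.Unary.All as All using (All; []; _∷_; all?)
open import Data.List.Relation.Unary.All.Properties using (applyUpTo⁺₁)
open import Data.List.Relation.Unary.Any using (here; there)
open import Data.List.Relation.Unary.Linked as Linked using (Linked; []; [-]; _∷_)
open import Data.List.Relation.Unary.Unique.Propositional using (Unique)
import Data.List.Relation.Unary.Unique.Propositional.Properties as Unique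
open import Data.Maybe.Base using (Maybe; just; nothing)
open import Data.Nat.Base using (zero; suc; _+_; _*_; _∸_; _≤_; _<_; z≤n; s≤s; z<s; s≤s⁻¹; NonZero)
open import Data.Nat.Divisibility
  using (_∣_; _∤_; _∣?_; _∣0; divides-refl; ∣-refl; ∣m∣n⇒∣m+n; ∣m+n∣m⇒∣n; ∣n⇒∣m*n; >⇒∤)
open import Data.Nat.ListAction using (sum)
open import Data.Nat.ListAction.Properties using (sum-++; sum-↭)
open import Data.Nat.Properties
open import Algebra.Properties.CommutativeSemigroup +-commutativeSemigroup using (interchange)
open import Data.Product.Base using (_×_; _,_; proj₂; map₁)
open import Data.Sum.Base using ([_,_]′)
open import Function.Base using (_∘_; _∘′_)
open import Function.Bundles using (mk⇔; Equivalence)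
open import Level using (0ℓ)
open import Relation.Binary.PropositionalEquality
import Relation.Binary.Reasoning.Setoid as Setoid-Reasoning
open import Relation.Nullary.Decidable
  using (Dec; does; yes; no; _×-dec_; dec-true; dec-false; does-⇔)
open import Relation.Nullary.Negation using (contradiction)
open import Relation.Unary using (Pred; Decidable)

-- The ring of power series in q over ℤ

Series : Set
Series = ℕ → ℤ

infix  4 _≈_
infixl 6 _⊕_
infixl 7 _⊛_
infix  8 ⊝_

-- A record rather than the bare pointwise type, so that unification can recover `f` and `g` from an
-- equation.
record _≈_ (f g : Series) : Set where
  constructor coefficientwise
  field coeff≡ : ∀ n → f n ≡ g n
open _≈_

const : ℤ → Series
const c zero    = c
const c (suc n) = 0ℤ

tail : Series → Series
tail f n = f (suc n)

-- Opaque, since otherwise the ring solver unfolds the operations to coefficients.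
opaque
  _⊕_ : Series → Series → Series
  (f ⊕ g) n = f n ℤ.+ g n

  ⊝_ : Series → Series
  (⊝ f) n = ℤ.- f n

  _⊛_ : Series → Series → Series
  (f ⊛ g) zero    = f 0 ℤ.* g 0
  (f ⊛ g) (suc n) = f 0 ℤ.* g (suc n) ℤ.+ (tail f ⊛ g) n

  coeff-⊕ : ∀ f g n → (f ⊕ g) n ≡ f n ℤ.+ g n
  coeff-⊕ f g n = refl

  private
    ⊛-congₙ : ∀ {f f′ g g′} → (∀ n → f n ≡ f′ n) → (∀ n → g n ≡ g′ n) →
              ∀ n → (f ⊛ g) n ≡ (f′ ⊛ g′) n
    ⊛-congₙ p q zero    = cong₂ ℤ._*_ (p 0) (q 0)
    ⊛-congₙ p q (suc n) = cong₂ ℤ._+_ (cong₂ ℤ._*_ (p 0) (q (suc n)))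
                                      (⊛-congₙ (λ k → p (suc k)) q n)

    ⊛-distribʳₙ : ∀ f g h n → ((f ⊕ g) ⊛ h) n ≡ (f ⊛ h ⊕ g ⊛ h) n
    ⊛-distribʳₙ f g h zero    = ℤ.*-distribʳ-+ (h 0) (f 0) (g 0)
    ⊛-distribʳₙ f g h (suc n) = trans
      (cong (λ s → (f 0 ℤ.+ g 0) ℤ.* h (suc n) ℤ.+ s) (⊛-distribʳₙ (tail f) (tail g) h n))
      (lemma (f 0) (g 0) (h (suc n)) ((tail f ⊛ h) n) ((tail g ⊛ h) n))
      where
      lemma : ∀ a b c x y →
              (a ℤ.+ b) ℤ.* c ℤ.+ (x ℤ.+ y) ≡ a ℤ.* c ℤ.+ x ℤ.+ (b ℤ.* c ℤ.+ y)
      lemma = solve-∀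

    -- The product is defined by peeling off the head of the left factor; this is the mirror image,
    -- and commutativity follows by comparing the two.
    ⊛-sucʳ : ∀ f g n → (f ⊛ g) (suc n) ≡ f (suc n) ℤ.* g 0 ℤ.+ (f ⊛ tail g) n
    ⊛-sucʳ f g zero    = ℤ.+-comm (f 0 ℤ.* g 1) (f 1 ℤ.* g 0)
    ⊛-sucʳ f g (suc n) = trans
      (cong (λ s → f 0 ℤ.* g (suc (suc n)) ℤ.+ s) (⊛-sucʳ (tail f) g n))
      (lemma (f 0 ℤ.* g (suc (suc n))) (f (suc (suc n)) ℤ.* g 0) ((tail f ⊛ tail g) n))
      where
      lemma : ∀ a b c → a ℤ.+ (b ℤ.+ c) ≡ b ℤ.+ (a ℤ.+ c)
      lemma = solve-∀

    ⊛-commₙ : ∀ f g n → (f ⊛ g) n ≡ (g ⊛ f) n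
    ⊛-commₙ f g zero    = ℤ.*-comm (f 0) (g 0)
    ⊛-commₙ f g (suc n) = trans
      (cong₂ ℤ._+_ (ℤ.*-comm (f 0) (g (suc n))) (⊛-commₙ (tail f) g n))
      (sym (⊛-sucʳ g f n))

    ⊛-scale : ∀ c f g n → ((λ k → c ℤ.* f k) ⊛ g) n ≡ c ℤ.* (f ⊛ g) n
    ⊛-scale c f g zero    = ℤ.*-assoc c (f 0) (g 0)
    ⊛-scale c f g (suc n) = trans
      (cong (λ s → c ℤ.* f 0 ℤ.* g (suc n) ℤ.+ s) (⊛-scale c (tail f) g n))
      (lemma c (f 0) (g (suc n)) ((tail f ⊛ g) n))
      where
      lemma : ∀ c a b x → c ℤ.* a ℤ.* b ℤ.+ c ℤ.* x ≡ c ℤ.* (a ℤ.* b ℤ.+ x)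
      lemma = solve-∀

    -- By definition `tail (f ⊛ g)` is `f 0` times `tail g` plus `tail f ⊛ g`, so distributivity and
    -- scaling reduce the claim to `tail f`.
    ⊛-assocₙ : ∀ f g h n → ((f ⊛ g) ⊛ h) n ≡ (f ⊛ (g ⊛ h)) n
    ⊛-assocₙ f g h zero    = ℤ.*-assoc (f 0) (g 0) (h 0)
    ⊛-assocₙ f g h (suc n) = begin
      f 0 ℤ.* g 0 ℤ.* h (suc n) ℤ.+ (tail (f ⊛ g) ⊛ h) n
        ≡⟨ cong (λ s → f 0 ℤ.* g 0 ℤ.* h (suc n) ℤ.+ s)
             (⊛-distribʳₙ (λ k → f 0 ℤ.* g (suc k)) (tail f ⊛ g) h n) ⟩
      f 0 ℤ.* g 0 ℤ.* h (suc n) ℤ.+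
        (((λ k → f 0 ℤ.* g (suc k)) ⊛ h) n ℤ.+ ((tail f ⊛ g) ⊛ h) n)
        ≡⟨ cong (λ s → f 0 ℤ.* g 0 ℤ.* h (suc n) ℤ.+ s)
             (cong₂ ℤ._+_ (⊛-scale (f 0) (tail g) h n) (⊛-assocₙ (tail f) g h n)) ⟩
      f 0 ℤ.* g 0 ℤ.* h (suc n) ℤ.+
        (f 0 ℤ.* (tail g ⊛ h) n ℤ.+ (tail f ⊛ (g ⊛ h)) n)
        ≡⟨ lemma (f 0) (g 0) (h (suc n)) ((tail g ⊛ h) n) ((tail f ⊛ (g ⊛ h)) n) ⟩
      f 0 ℤ.* (g 0 ℤ.* h (suc n) ℤ.+ (tail g ⊛ h) n) ℤ.+ (tail f ⊛ (g ⊛ h)) n ∎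
      where
      open ≡-Reasoning
      lemma : ∀ a b c x y →
              a ℤ.* b ℤ.* c ℤ.+ (a ℤ.* x ℤ.+ y) ≡ a ℤ.* (b ℤ.* c ℤ.+ x) ℤ.+ y
      lemma = solve-∀

    ⊛-zeroₙ : ∀ f n → ((λ _ → 0ℤ) ⊛ f) n ≡ 0ℤ
    ⊛-zeroₙ f zero    = refl
    ⊛-zeroₙ f (suc n) = trans (ℤ.+-identityˡ _) (⊛-zeroₙ f n)

    const-⊛ₙ : ∀ c f n → (const c ⊛ f) n ≡ c ℤ.* f n
    const-⊛ₙ c f zero    = refl
    const-⊛ₙ c f (suc n) = trans (cong (λ s → c ℤ.* f (suc n) ℤ.+ s) (⊛-zeroₙ f n)) (ℤ.+-identityʳ _)

    const-0 : ∀ n → const 0ℤ n ≡ 0ℤ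
    const-0 zero    = refl
    const-0 (suc n) = refl

  const-+ : ∀ a b → const (a ℤ.+ b) ≈ const a ⊕ const b
  const-+ a b .coeff≡ zero    = refl
  const-+ a b .coeff≡ (suc n) = refl

  const-* : ∀ a b → const (a ℤ.* b) ≈ const a ⊛ const b
  const-* a b .coeff≡ zero    = refl
  const-* a b .coeff≡ (suc n) = sym (trans (const-⊛ₙ a (const b) (suc n)) (ℤ.*-zeroʳ a))

  const-‿ : ∀ a → const (ℤ.- a) ≈ ⊝ const a
  const-‿ a .coeff≡ zero    = refl
  const-‿ a .coeff≡ (suc n) = refl

  isCommutativeRing : IsCommutativeRing _≈_ _⊕_ _⊛_ ⊝_ (const 0ℤ) (const 1ℤ)
  isCommutativeRing = record
    { isRing = record
      { +-isAbelianGroup = record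
        { isGroup = record
          { isMonoid = record
            { isSemigroup = record
              { isMagma = record
                { isEquivalence = record
                  { refl  = coefficientwise λ _ → refl
                  ; sym   = λ p → coefficientwise λ n → sym (coeff≡ p n)
                  ; trans = λ p q → coefficientwise λ n → trans (coeff≡ p n) (coeff≡ q n)
                  }
                ; ∙-cong = λ p q → coefficientwise λ n → cong₂ ℤ._+_ (coeff≡ p n) (coeff≡ q n)
                }
              ; assoc = λ f g h → coefficientwise λ n → ℤ.+-assoc (f n) (g n) (h n)
              }
            ; identity =
                (λ f → coefficientwise λ n →
                  trans (cong (λ s → s ℤ.+ f n) (const-0 n)) (ℤ.+-identityˡ (f n))) ,
                (λ f → coefficientwise λ n →
                  trans (cong (λ s → f n ℤ.+ s) (const-0 n)) (ℤ.+-identityʳ (f n)))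
            }
          ; inverse =
              (λ f → coefficientwise λ n → trans (ℤ.+-inverseˡ (f n)) (sym (const-0 n))) ,
              (λ f → coefficientwise λ n → trans (ℤ.+-inverseʳ (f n)) (sym (const-0 n)))
          ; ⁻¹-cong = λ p → coefficientwise λ n → cong ℤ.-_ (coeff≡ p n)
          }
        ; comm = λ f g → coefficientwise λ n → ℤ.+-comm (f n) (g n)
        }
      ; *-cong = λ p q → coefficientwise (⊛-congₙ (coeff≡ p) (coeff≡ q))
      ; *-assoc = λ f g h → coefficientwise (⊛-assocₙ f g h)
      ; *-identity =
          (λ f → coefficientwise λ n → trans (const-⊛ₙ 1ℤ f n) (ℤ.*-identityˡ (f n))) ,
          (λ f → coefficientwise λ n →
            trans (⊛-commₙ f (const 1ℤ) n) (trans (const-⊛ₙ 1ℤ f n) (ℤ.*-identityˡ (f n))))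
      ; distrib =
          (λ f g h → coefficientwise λ n →
            trans (⊛-commₙ f (g ⊕ h) n)
              (trans (⊛-distribʳₙ g h f n) (cong₂ ℤ._+_ (⊛-commₙ g f n) (⊛-commₙ h f n)))) ,
          (λ f g h → coefficientwise (⊛-distribʳₙ g h f))
      }
    ; *-comm = λ f g → coefficientwise (⊛-commₙ f g)
    }

seriesRing : CommutativeRing 0ℓ 0ℓ
seriesRing = record { isCommutativeRing = isCommutativeRing }

module R = CommutativeRing seriesRing
module ≈R = Setoid-Reasoning R.setoid
open Exp R.semiring using (_^_; ^-homo-*)

constants : CommutativeRing.rawRing ℤ.+-*-commutativeRing
            -Raw-AlmostCommutative⟶ fromCommutativeRing seriesRing
constants = record
  { ⟦_⟧ = const ; +-homo = const-+ ; *-homo = const-* ; -‿homo = const-‿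
  ; 0-homo = R.refl ; 1-homo = R.refl }

constant≟ : ∀ a b → Maybe (const a ≈ const b)
constant≟ a b with a ℤ.≟ b
... | yes a≡b = just (R.reflexive (cong const a≡b))
... | no  _   = nothing

open RingSolver (CommutativeRing.rawRing ℤ.+-*-commutativeRing)
  (fromCommutativeRing seriesRing) constants constant≟

q : Series
q 1 = 1ℤ
q _ = 0ℤ

infix 9 q^_
q^_ : ℕ → Series
q^ m = q ^ m

opaque
  unfolding _⊛_

  coeff-0 : ∀ n → const 0ℤ n ≡ 0ℤ
  coeff-0 = const-0

  q-⊛-suc : ∀ f n → (q ⊛ f) (suc n) ≡ f n
  q-⊛-suc f n = trans (ℤ.+-identityˡ _) (trans (lemma n)
    (trans (const-⊛ₙ 1ℤ f n) (ℤ.*-identityˡ (f n))))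
    where
    tail-q : ∀ k → tail q k ≡ const 1ℤ k
    tail-q zero    = refl
    tail-q (suc k) = refl
    lemma : ∀ n → (tail q ⊛ f) n ≡ (const 1ℤ ⊛ f) n
    lemma = ⊛-congₙ tail-q (λ _ → refl)

  q-⊛-zero : ∀ f → (q ⊛ f) 0 ≡ 0ℤ
  q-⊛-zero f = refl

q^-⊛-< : ∀ m f {n} → n < m → (q^ m ⊛ f) n ≡ 0ℤ
q^-⊛-< (suc m) f {zero}  _         = trans (coeff≡ (R.*-assoc q (q^ m) f) 0) (q-⊛-zero _)
q^-⊛-< (suc m) f {suc n} (s≤s p) = trans (coeff≡ (R.*-assoc q (q^ m) f) (suc n))
  (trans (q-⊛-suc _ n) (q^-⊛-< m f p))

q^-⊛-+ : ∀ m f n → (q^ m ⊛ f) (m + n) ≡ f n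
q^-⊛-+ zero    f n = coeff≡ (R.*-identityˡ f) n
q^-⊛-+ (suc m) f n = trans (coeff≡ (R.*-assoc q (q^ m) f) (suc m + n))
  (trans (q-⊛-suc _ (m + n)) (q^-⊛-+ m f n))

-- Hooks in the first row of a Young diagram

private
  variable
    A B : Set
    t N n : ℕ
    μ : List ℕ
    φ ψ : List ℕ → ℕ

count : {P : Pred A 0ℓ} → Decidable P → List A → ℕ
count P? xs = length (filter P? xs)

-- Agreement is asked of the Booleans, not of the propositions: in most uses below both sides
-- compute to the same Boolean and `refl` suffices.
count-cong : {P Q : Pred A 0ℓ} (P? : Decidable P) (Q? : Decidable Q) →
             (∀ x → does (P? x) ≡ does (Q? x)) → ∀ xs → count P? xs ≡ count Q? xs
count-cong P? Q? eq []       = refl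
count-cong P? Q? eq (x ∷ xs) with does (P? x) | does (Q? x) | eq x
... | true  | _ | refl = cong suc (count-cong P? Q? eq xs)
... | false | _ | refl = count-cong P? Q? eq xs

count-++ : {P : Pred A 0ℓ} (P? : Decidable P) →
           ∀ xs ys → count P? (xs ++ ys) ≡ count P? xs + count P? ys
count-++ P? xs ys = trans (cong length (filter-++ P? xs ys)) (length-++ (filter P? xs))

count-map : {P : Pred B 0ℓ} (P? : Decidable P) (f : A → B) →
            ∀ xs → count P? (map f xs) ≡ count (P? ∘ f) xs
count-map P? f []       = refl
count-map P? f (x ∷ xs) with does (P? (f x))
... | true  = cong suc (count-map P? f xs)
... | false = count-map P? f xs

count-all : {P : Pred A 0ℓ} (P? : Decidable P) → (∀ x → does (P? x) ≡ true) →
            ∀ xs → count P? xs ≡ length xs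
count-all P? eq []       = refl
count-all P? eq (x ∷ xs) with does (P? x) | eq x
... | true | refl = cong suc (count-all P? eq xs)

count-none : {P : Pred A 0ℓ} (P? : Decidable P) → (∀ x → does (P? x) ≡ false) →
             ∀ xs → count P? xs ≡ 0
count-none P? eq []       = refl
count-none P? eq (x ∷ xs) with does (P? x) | eq x
... | false | refl = count-none P? eq xs

𝟙 : ∀ {X : Set} → Dec X → ℕ
𝟙 d = if does d then 1 else 0

count-∷ : {P : Pred A 0ℓ} (P? : Decidable P) →
          ∀ x xs → count P? (x ∷ xs) ≡ 𝟙 (P? x) + count P? xs
count-∷ P? x xs with does (P? x)
... | true  = refl
... | false = refl

upTo-suc : ∀ r → upTo (suc r) ≡ 0 ∷ map suc (upTo r)
upTo-suc r = cong (0 ∷_) (sym (map-upTo suc r))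

count-<-upTo : ∀ j r → count (j <?_) (upTo r) ≡ r ∸ suc j
count-<-upTo j       zero    = refl
count-<-upTo zero    (suc r) = trans (cong (count (0 <?_)) (upTo-suc r))
  (trans (count-map (0 <?_) suc (upTo r))
    (trans (count-all (λ x → 0 <? suc x) (λ _ → refl) (upTo r)) (length-upTo r)))
count-<-upTo (suc j) (suc r) = trans (cong (count (suc j <?_)) (upTo-suc r))
  (trans (count-map (suc j <?_) suc (upTo r))
    (trans (count-cong (λ x → suc j <? suc x) (j <?_) (λ _ → refl) (upTo r)) (count-<-upTo j r)))

count-≟-upTo : ∀ j r → count (_≟ j) (upTo r) ≡ 𝟙 (j <? r)
count-≟-upTo j       zero    = refl
count-≟-upTo zero    (suc r) = trans (cong (count (_≟ 0)) (upTo-suc r))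
  (cong suc (trans (count-map (_≟ 0) suc (upTo r))
    (count-none (λ x → suc x ≟ 0) (λ _ → refl) (upTo r))))
count-≟-upTo (suc j) (suc r) = trans (cong (count (_≟ suc j)) (upTo-suc r))
  (trans (count-map (_≟ suc j) suc (upTo r))
    (trans (count-cong (λ x → suc x ≟ suc j) (_≟ j) (λ _ → refl) (upTo r)) (count-≟-upTo j r)))

count-young : {P : Pred Box 0ℓ} (P? : Decidable P) → ∀ r μ → count P? (youngDiagram (r ∷ μ)) ≡
  count (λ j → P? (0 , j)) (upTo r) + count (P? ∘ map₁ suc) (youngDiagram μ)
count-young P? r μ = trans (count-++ P? (map (0 ,_) (upTo r)) _)
  (cong₂ _+_ (count-map P? (0 ,_) (upTo r)) (count-map P? (map₁ suc) (youngDiagram μ)))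

longer : ℕ → List ℕ → ℕ
longer j = count (j <?_)

columnLength : ∀ j μ → count (λ (x : Box) → proj₂ x ≟ j) (youngDiagram μ) ≡ longer j μ
columnLength j []      = refl
columnLength j (r ∷ μ) = trans (count-young (λ x → proj₂ x ≟ j) r μ)
  (trans (cong₂ _+_ (count-≟-upTo j r) (columnLength j μ)) (sym (count-∷ (j <?_) r μ)))

hookLength-firstRow : ∀ r μ j →
  hookLength (youngDiagram (r ∷ μ)) (0 , j) ≡ (r ∸ suc j) + longer j μ + 1
hookLength-firstRow r μ j = cong (_+ 1) (cong₂ _+_
  (trans (count-young (λ (i′ , j′) → (i′ ≟ 0) ×-dec (j <? j′)) r μ)
    (trans (cong₂ _+_
      (trans (count-cong (λ j′ → (0 ≟ 0) ×-dec (j <? j′)) (j <?_) (λ _ → refl) (upTo r))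
             (count-<-upTo j r))
      (count-none (λ (i′ , j′) → (suc i′ ≟ 0) ×-dec (j <? j′)) (λ _ → refl) (youngDiagram μ)))
      (+-identityʳ _)))
  (trans (count-young (λ (i′ , j′) → (0 <? i′) ×-dec (j′ ≟ j)) r μ)
    (cong₂ _+_
      (count-none (λ j′ → (0 <? 0) ×-dec (j′ ≟ j)) (λ _ → refl) (upTo r))
      (trans (count-cong (λ (i′ , j′) → (0 <? suc i′) ×-dec (j′ ≟ j)) (λ x → proj₂ x ≟ j)
                         (λ _ → refl) (youngDiagram μ))
             (columnLength j μ)))))

-- Hooks extend only to the right and downwards, so a row placed on top does not change them.
hookLength-laterRow : ∀ r μ x →
  hookLength (youngDiagram (r ∷ μ)) (map₁ suc x) ≡ hookLength (youngDiagram μ) x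
hookLength-laterRow r μ (i , j) = cong (_+ 1) (cong₂ _+_
  (trans (count-young (λ (i′ , j′) → (i′ ≟ suc i) ×-dec (j <? j′)) r μ)
    (cong₂ _+_
      (count-none (λ j′ → (0 ≟ suc i) ×-dec (j <? j′)) (λ _ → refl) (upTo r))
      (count-cong (λ (i′ , j′) → (suc i′ ≟ suc i) ×-dec (j <? j′))
                  (λ (i′ , j′) → (i′ ≟ i) ×-dec (j <? j′)) (λ _ → refl) (youngDiagram μ))))
  (trans (count-young (λ (i′ , j′) → (suc i <? i′) ×-dec (j′ ≟ j)) r μ)
    (cong₂ _+_
      (count-none (λ j′ → (suc i <? 0) ×-dec (j′ ≟ j)) (λ _ → refl) (upTo r))
      (count-cong (λ (i′ , j′) → (suc i <? suc i′) ×-dec (j′ ≟ j))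
                  (λ (i′ , j′) → (i <? i′) ×-dec (j′ ≟ j)) (λ _ → refl) (youngDiagram μ)))))

hooks-∷ : ∀ k r μ → hooks k (r ∷ μ) ≡
  count (λ j → (r ∸ suc j) + longer j μ + 1 ≟ k) (upTo r) + hooks k μ
hooks-∷ k r μ = trans (count-young (λ x → hookLength (youngDiagram (r ∷ μ)) x ≟ k) r μ)
  (cong₂ _+_
    (count-cong _ _ (λ j → cong (λ h → does (h ≟ k)) (hookLength-firstRow r μ j)) (upTo r))
    (count-cong _ _ (λ x → cong (λ h → does (h ≟ k)) (hookLength-laterRow r μ x)) (youngDiagram μ)))

exactly : ℕ → ℕ → List ℕ → ℕ
exactly k j μ = 𝟙 (longer j μ ≟ k)

hook3? : ∀ r μ (j : ℕ) → Dec ((r ∸ suc j) + longer j μ + 1 ≡ 3)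
hook3? r μ j = (r ∸ suc j) + longer j μ + 1 ≟ 3

𝟙-hook : ∀ a l k → 𝟙 (a + l + 1 ≟ a + k + 1) ≡ 𝟙 (l ≟ k)
𝟙-hook zero    zero    zero    = refl
𝟙-hook zero    zero    (suc k) rewrite +-comm k 1 = refl
𝟙-hook zero    (suc l) zero    rewrite +-comm l 1 = refl
𝟙-hook zero    (suc l) (suc k) = 𝟙-hook zero l k
𝟙-hook (suc a) l       k       = 𝟙-hook a l k

hooks3-1 : ∀ μ → hooks 3 (1 ∷ μ) ≡ exactly 2 0 μ + hooks 3 μ
hooks3-1 μ = trans (hooks-∷ 3 1 μ) (cong (_+ hooks 3 μ)
  (trans (count-∷ (hook3? 1 μ) 0 []) (trans (+-identityʳ _) (𝟙-hook 0 (longer 0 μ) 2))))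

hooks3-2 : ∀ μ → hooks 3 (2 ∷ μ) ≡ exactly 1 0 μ + exactly 2 1 μ + hooks 3 μ
hooks3-2 μ = trans (hooks-∷ 3 2 μ) (cong (_+ hooks 3 μ)
  (trans (count-∷ (hook3? 2 μ) 0 (1 ∷ [])) (cong₂ _+_ (𝟙-hook 1 (longer 0 μ) 1)
    (trans (count-∷ (hook3? 2 μ) 1 []) (trans (+-identityʳ _) (𝟙-hook 0 (longer 1 μ) 2))))))

-- A hook of length 3 has at most 2 boxes to its right, so only the last three columns `m`, `1 + m`,
-- `2 + m` matter. With 2, 1, 0 boxes to the right it needs 0, 1, 2 below, and column `j` has
-- `longer j μ` boxes below the first row.
hooks3-3+ : ∀ m μ → hooks 3 (3 + m ∷ μ) ≡
  exactly 0 m μ + (exactly 1 (1 + m) μ + exactly 2 (2 + m) μ) + hooks 3 μ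
hooks3-3+ m μ = trans (hooks-∷ 3 (3 + m) μ) (cong (_+ hooks 3 μ) (begin
  count h? (upTo (3 + m))
    ≡⟨ cong (count h?) split ⟩
  count h? (upTo m ++ m ∷ 1 + m ∷ 2 + m ∷ [])
    ≡⟨ count-++ h? (upTo m) _ ⟩
  count h? (upTo m) + count h? (m ∷ 1 + m ∷ 2 + m ∷ [])
    ≡⟨ cong (_+ count h? (m ∷ 1 + m ∷ 2 + m ∷ [])) (cong length (filter-none h?
         (applyUpTo⁺₁ (λ j → j) m λ {j} j<m eq → 1+n≢0 (suc-injective (suc-injective (suc-injective (begin
           4 + (m ∸ suc j) + longer j μ        ≡⟨ +-comm 1 _ ⟩
           3 + (m ∸ suc j) + longer j μ + 1    ≡⟨ cong (λ a → a + longer j μ + 1) (+-∸-assoc 3 j<m) ⟨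
           (3 + m ∸ suc j) + longer j μ + 1    ≡⟨ eq ⟩
           3                                   ∎))))))) ⟩
  count h? (m ∷ 1 + m ∷ 2 + m ∷ [])
    ≡⟨ trans (count-∷ h? m _) (cong (𝟙 (h? m) +_) (trans (count-∷ h? (1 + m) _)
         (cong (𝟙 (h? (1 + m)) +_) (trans (count-∷ h? (2 + m) []) (+-identityʳ _))))) ⟩
  𝟙 (h? m) + (𝟙 (h? (1 + m)) + 𝟙 (h? (2 + m)))
    ≡⟨ cong₂ _+_ (last 2 m 0 refl) (cong₂ _+_ (last 1 (1 + m) 1 refl) (last 0 (2 + m) 2 refl)) ⟩
  exactly 0 m μ + (exactly 1 (1 + m) μ + exactly 2 (2 + m) μ) ∎))
  where
  open ≡-Reasoning
  h? : Decidable _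
  h? = hook3? (3 + m) μ
  split : upTo (3 + m) ≡ upTo m ++ m ∷ 1 + m ∷ 2 + m ∷ []
  split = begin
    upTo (3 + m)                                   ≡⟨ upTo-∷ʳ (2 + m) ⟨
    upTo (2 + m) ∷ʳ (2 + m)                        ≡⟨ cong (_∷ʳ (2 + m)) (upTo-∷ʳ (1 + m)) ⟨
    (upTo (1 + m) ∷ʳ (1 + m)) ∷ʳ (2 + m)
      ≡⟨ cong (λ xs → (xs ∷ʳ (1 + m)) ∷ʳ (2 + m)) (upTo-∷ʳ m) ⟨
    ((upTo m ∷ʳ m) ∷ʳ (1 + m)) ∷ʳ (2 + m)          ≡⟨ ++-assoc (upTo m ∷ʳ m) _ _ ⟩
    (upTo m ∷ʳ m) ++ (1 + m ∷ 2 + m ∷ [])           ≡⟨ ++-assoc (upTo m) _ _ ⟩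
    upTo m ++ m ∷ 1 + m ∷ 2 + m ∷ []               ∎
  last : ∀ a j k → a + k ≡ 2 → 𝟙 (hook3? (suc a + j) μ j) ≡ exactly k j μ
  last a j k eq = trans
    (cong₂ (λ s c → 𝟙 (s + longer j μ + 1 ≟ c)) (m+n∸n≡m a j) (sym (cong (_+ 1) eq)))
    (𝟙-hook a (longer j μ) k)

-- Generating functions of partitions with bounded parts

record Bounded (t N n : ℕ) (μ : List ℕ) : Set where
  constructor mkBounded
  field
    decreasing : Linked _≥_ μ
    positive   : All (0 <_) μ
    total      : sum μ ≡ n
    regular    : Regular t μ
    parts≤     : All (_≤ N) μ
open Bounded

parts≤sum : ∀ μ → All (_≤ sum μ) μ
parts≤sum []      = []
parts≤sum (p ∷ μ) = m≤m+n p _ ∷ All.map (λ r≤ → ≤-trans r≤ (m≤n+m _ p)) (parts≤sum μ)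

opaque
  bounded : ℕ → ℕ → ℕ → List (List ℕ)
  bounded t N n = filter (all? (_≤? N)) (filter (regular? t) (partitions n))

  ∈-bounded⁺ : Bounded t N n μ → μ ∈ bounded t N n
  ∈-bounded⁺ {t} {N} {n} (mkBounded l p s r b) =
    ∈-filter⁺ (all? (_≤? N)) (∈-filter⁺ (regular? t) (Equivalence.from ∈-partitions (l , p , s)) r) b

  ∈-bounded⁻ : μ ∈ bounded t N n → Bounded t N n μ
  ∈-bounded⁻ {t = t} {N} {n} μ∈ =
    let μ∈′ , b = ∈-filter⁻ (all? (_≤? N)) {xs = filter (regular? t) (partitions n)} μ∈
        μ∈″ , r = ∈-filter⁻ (regular? t) {xs = partitions n} μ∈′
        l , p , s = Equivalence.to ∈-partitions μ∈″
    in mkBounded l p s r b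

  bounded-unique : ∀ t N n → Unique (bounded t N n)
  bounded-unique t N n = Unique.filter⁺ (all? (_≤? N)) (Unique.filter⁺ (regular? t) (partitions-unique n))

  bounded-0-0 : ∀ t → bounded t 0 0 ≡ [] ∷ []
  bounded-0-0 t = refl

  bounded-full : ∀ t {N n} → n ≤ N → bounded t N n ≡ filter (regular? t) (partitions n)
  bounded-full t {N} {n} n≤N = filter-all (all? (_≤? N))
    (All.tabulate λ {μ} μ∈ →
      let μ∈′ , _ = ∈-filter⁻ (regular? t) {xs = partitions n} μ∈
          _ , _ , s = Equivalence.to ∈-partitions μ∈′
      in All.map (λ p≤ → ≤-trans p≤ (≤-trans (≤-reflexive s) n≤N)) (parts≤sum μ))

-- Weighted sums depend only on the bag of partitions, and without repetitions the bag is determined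
-- by the set. The order of enumeration thus never matters.
sameElements⇒↭ : {xs ys : List (List ℕ)} → Unique xs → Unique ys →
                 (∀ {μ} → μ ∈ xs → μ ∈ ys) → (∀ {μ} → μ ∈ ys → μ ∈ xs) → xs ↭ ys
sameElements⇒↭ u v f g = ∼bag⇒↭ (unique∧set⇒bag u v (mk⇔ f g))

bound⇒Linked : ∀ {p} → All (_≤ p) μ → Linked _≥_ μ → Linked _≥_ (p ∷ μ)
bound⇒Linked []      []  = [-]
bound⇒Linked (q ∷ _) l   = q ∷ l

Linked⇒≤head : ∀ {p} → Linked _≥_ (p ∷ μ) → All (_≤ p) μ
Linked⇒≤head [-]     = []
Linked⇒≤head (q ∷ l) = q ∷ All.map (λ r≤ → ≤-trans r≤ q) (Linked⇒≤head l)

sharpen : (∀ {p} → p ∈ μ → p ≤ suc N → p ≢ suc N) → Bounded t (suc N) n μ → Bounded t N n μ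
sharpen ne (mkBounded l p s r b) =
  mkBounded l p s r (All.tabulate λ x∈ → s≤s⁻¹ (≤∧≢⇒< (All.lookup b x∈) (ne x∈ (All.lookup b x∈))))

weaken : Bounded t N n μ → Bounded t (suc N) n μ
weaken (mkBounded l p s r b) = mkBounded l p s r (All.map m≤n⇒m≤1+n b)

bounded-multiple : t ∣ suc N → bounded t (suc N) n ↭ bounded t N n
bounded-multiple {t} {N} {n} t∣ = sameElements⇒↭ (bounded-unique t (suc N) n) (bounded-unique t N n)
  (λ μ∈ → let β = ∈-bounded⁻ μ∈ in
    ∈-bounded⁺ (sharpen (λ { p∈ _ refl → All.lookup (regular β) p∈ t∣ }) β))
  (∈-bounded⁺ ∘′ weaken ∘′ ∈-bounded⁻)

bounded-small : n < suc N → bounded t (suc N) n ↭ bounded t N n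
bounded-small {n} {N} {t} n< = sameElements⇒↭ (bounded-unique t (suc N) n) (bounded-unique t N n)
  (λ {μ} μ∈ → let β = ∈-bounded⁻ μ∈ in
    ∈-bounded⁺ (sharpen (λ { p∈ _ refl →
      <⇒≱ n< (subst (suc N ≤_) (total β) (All.lookup (parts≤sum μ) p∈)) }) β))
  (∈-bounded⁺ ∘′ weaken ∘′ ∈-bounded⁻)

-- Either no part equals `suc N`, or the first one does and can be removed. Parts may repeat, so
-- what remains is still bounded by `suc N`, not by `N`.
bounded-split : t ∤ suc N → bounded t (suc N) (suc N + n) ↭
  bounded t N (suc N + n) ++ map (suc N ∷_) (bounded t (suc N) n)
bounded-split {t} {N} {n} t∤ = sameElements⇒↭ (bounded-unique t (suc N) (suc N + n))
  (Unique.++⁺ (bounded-unique t N _)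
    (Unique.map⁺ (λ { refl → refl }) (bounded-unique t (suc N) n)) disjoint)
  (λ {μ} μ∈ → to μ (∈-bounded⁻ μ∈))
  (λ μ∈ → [ ∈-bounded⁺ ∘′ weaken ∘′ ∈-bounded⁻ , from ]′ (∈-++⁻ (bounded t N (suc N + n)) μ∈))
  where
  disjoint : ∀ {μ} → μ ∈ bounded t N (suc N + n) × μ ∈ map (suc N ∷_) (bounded t (suc N) n) → _
  disjoint (μ∈ , μ∈′) with _ , _ , refl ← ∈-map⁻ (suc N ∷_) μ∈′ =
    1+n≰n (All.head (parts≤ (∈-bounded⁻ {N = N} μ∈)))
  from : ∀ {μ} → μ ∈ map (suc N ∷_) (bounded t (suc N) n) → μ ∈ bounded t (suc N) (suc N + n)
  from μ∈ with ν , ν∈ , refl ← ∈-map⁻ (suc N ∷_) μ∈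
    with mkBounded l p s r b ← ∈-bounded⁻ {N = suc N} ν∈ =
    ∈-bounded⁺ (mkBounded (bound⇒Linked b l) (z<s ∷ p) (cong (suc N +_) s) (t∤ ∷ r) (≤-refl ∷ b))
  to : ∀ μ → Bounded t (suc N) (suc N + n) μ →
       μ ∈ bounded t N (suc N + n) ++ map (suc N ∷_) (bounded t (suc N) n)
  to [] β = contradiction (total β) λ ()
  to (p ∷ μ) β@(mkBounded l (_ ∷ p>0) s (_ ∷ r) (p≤ ∷ b)) with p ≟ suc N
  ... | yes refl = ∈-++⁺ʳ (bounded t N (suc N + n)) (∈-map⁺ (suc N ∷_)
          (∈-bounded⁺ (mkBounded (Linked.tail l) p>0 (+-cancelˡ-≡ (suc N) _ _ s) r b)))
  ... | no p≢ = ∈-++⁺ˡ (∈-bounded⁺ (sharpen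
          (λ { (here refl) _ → p≢
             -- A later part `suc N` is at most the first part `p`, which would force `p ≡ suc N`.
             ; (there x∈) _ refl → p≢ (≤-antisym p≤ (All.lookup (Linked⇒≤head l) x∈)) }) β))

-- Σ φ(μ) q^|μ| over the t-regular partitions μ with parts at most N.
weighted : ℕ → ℕ → (List ℕ → ℕ) → Series
weighted t N φ n = pos (sum (map φ (bounded t N n)))

weighted-cong : (∀ {μ} → All (_≤ N) μ → φ μ ≡ ψ μ) → weighted t N φ ≈ weighted t N ψ
weighted-cong {N} {φ} {ψ} {t} eq .coeff≡ n =
  cong (pos ∘ sum) (go (bounded t N n) (λ μ∈ → parts≤ (∈-bounded⁻ {t = t} {n = n} μ∈)))
  where
  go : ∀ xs → (∀ {μ} → μ ∈ xs → All (_≤ N) μ) → map φ xs ≡ map ψ xs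
  go []       h = refl
  go (x ∷ xs) h = cong₂ _∷_ (eq (h (here refl))) (go xs (h ∘ there))

sum-map-+ : ∀ (φ ψ : List ℕ → ℕ) xs →
            sum (map (λ μ → φ μ + ψ μ) xs) ≡ sum (map φ xs) + sum (map ψ xs)
sum-map-+ φ ψ []       = refl
sum-map-+ φ ψ (x ∷ xs) = trans (cong (φ x + ψ x +_) (sum-map-+ φ ψ xs))
  (interchange (φ x) (ψ x) (sum (map φ xs)) (sum (map ψ xs)))

weighted-+ : ∀ t N φ ψ → weighted t N (λ μ → φ μ + ψ μ) ≈ weighted t N φ ⊕ weighted t N ψ
weighted-+ t N φ ψ .coeff≡ n = trans (cong pos (sum-map-+ φ ψ (bounded t N n)))
  (sym (coeff-⊕ (weighted t N φ) (weighted t N ψ) n))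

sum-map-0 : ∀ (xs : List (List ℕ)) → sum (map (λ _ → 0) xs) ≡ 0
sum-map-0 []       = refl
sum-map-0 (x ∷ xs) = sum-map-0 xs

weighted-0 : ∀ t N → weighted t N (λ _ → 0) ≈ const 0ℤ
weighted-0 t N .coeff≡ n = trans (cong pos (sum-map-0 (bounded t N n))) (sym (coeff-0 n))

weighted-multiple : t ∣ suc N → ∀ φ → weighted t (suc N) φ ≈ weighted t N φ
weighted-multiple t∣ φ .coeff≡ n = cong pos (sum-↭ (map⁺ φ (bounded-multiple t∣)))

-- The bound `suc N` recurs on the right, so for suitable `φ` this is a linear equation for the left
-- side, which `solve-u` solves. In degrees below `suc N` the second summand vanishes.
weighted-split : t ∤ suc N → ∀ φ →
  weighted t (suc N) φ ≈ weighted t N φ ⊕ q^ suc N ⊛ weighted t (suc N) (φ ∘ (suc N ∷_))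
weighted-split {t} {N} t∤ φ .coeff≡ n with n <? suc N
... | yes n< = begin
  weighted t (suc N) φ n              ≡⟨ cong pos (sum-↭ (map⁺ φ (bounded-small n<))) ⟩
  weighted t N φ n                    ≡⟨ ℤ.+-identityʳ _ ⟨
  weighted t N φ n ℤ.+ 0ℤ             ≡⟨ cong (λ s → weighted t N φ n ℤ.+ s) (q^-⊛-< (suc N) _ n<) ⟨
  weighted t N φ n ℤ.+ (q^ suc N ⊛ weighted t (suc N) (φ ∘ (suc N ∷_))) n ≡⟨ coeff-⊕ _ _ n ⟨
  _                                   ∎
  where open ≡-Reasoning
... | no n≮ with k , refl ← m≤n⇒∃[o]m+o≡n (≮⇒≥ n≮) = begin
  weighted t (suc N) φ (suc N + k)
    ≡⟨ cong pos (sum-↭ (map⁺ φ (bounded-split t∤))) ⟩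
  pos (sum (map φ (bounded t N (suc N + k) ++ map (suc N ∷_) (bounded t (suc N) k))))
    ≡⟨ cong (pos ∘ sum) (map-++ φ (bounded t N (suc N + k)) _) ⟩
  pos (sum (map φ (bounded t N (suc N + k)) ++ map φ (map (suc N ∷_) (bounded t (suc N) k))))
    ≡⟨ cong pos (sum-++ (map φ (bounded t N (suc N + k))) _) ⟩
  weighted t N φ (suc N + k) ℤ.+ pos (sum (map φ (map (suc N ∷_) (bounded t (suc N) k))))
    ≡⟨ cong (λ s → weighted t N φ (suc N + k) ℤ.+ pos (sum s)) (map-∘ (bounded t (suc N) k)) ⟨
  weighted t N φ (suc N + k) ℤ.+ weighted t (suc N) (φ ∘ (suc N ∷_)) k
    ≡⟨ cong (λ s → weighted t N φ (suc N + k) ℤ.+ s) (q^-⊛-+ (suc N) _ k) ⟨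
  weighted t N φ (suc N + k) ℤ.+ (q^ suc N ⊛ weighted t (suc N) (φ ∘ (suc N ∷_))) (suc N + k)
    ≡⟨ coeff-⊕ _ _ (suc N + k) ⟨
  _ ∎
  where open ≡-Reasoning

weighted-zero : ∀ t φ → weighted t 0 φ ≈ const (pos (φ []))
weighted-zero t φ .coeff≡ zero    =
  cong pos (trans (cong (sum ∘ map φ) (bounded-0-0 t)) (+-identityʳ (φ [])))
weighted-zero t φ .coeff≡ (suc n) =
  cong (pos ∘ sum ∘ map φ) (empty (bounded t 0 (suc n)) ∈-bounded⁻)
  where
  empty : ∀ xs → (∀ {μ} → μ ∈ xs → Bounded t 0 (suc n) μ) → xs ≡ []
  empty []       h = refl
  empty (μ ∷ xs) h with h (here refl)
  ... | mkBounded _ []      () _ _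
  ... | mkBounded _ (p ∷ _) _  _ (b ∷ _) = contradiction b (<⇒≱ p)

weighted-b : ∀ t k {N n} → n ≤ N → weighted t N (hooks k) n ≡ pos (b t k n)
weighted-b t k n≤N = cong (pos ∘ sum ∘ map (hooks k)) (bounded-full t n≤N)

regulars : ℕ → ℕ → Series
regulars t N = weighted t N (λ _ → 1)

longer-bounded : ∀ {N j} → N ≤ j → All (_≤ N) μ → longer j μ ≡ 0
longer-bounded {j = j} N≤j b =
  cong length (filter-none (j <?_) (All.map (λ p≤ → ≤⇒≯ (≤-trans p≤ N≤j)) b))

exactly-∷-0 : ∀ {j p} μ → j < p → exactly 0 j (p ∷ μ) ≡ 0
exactly-∷-0 {j} {p} μ j<p = cong (λ l → 𝟙 (l ≟ 0)) {y = suc (longer j μ)}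
  (trans (count-∷ (j <?_) p μ) (cong (λ d → (if d then 1 else 0) + longer j μ) (dec-true (j <? p) j<p)))

exactly-∷-suc : ∀ {j p} k μ → j < p → exactly (suc k) j (p ∷ μ) ≡ exactly k j μ
exactly-∷-suc {j} {p} k μ j<p = cong (λ l → 𝟙 (l ≟ suc k)) {y = suc (longer j μ)}
  (trans (count-∷ (j <?_) p μ) (cong (λ d → (if d then 1 else 0) + longer j μ) (dec-true (j <? p) j<p)))

weighted-exactly-0 : ∀ t N → weighted t N (exactly 0 N) ≈ regulars t N
weighted-exactly-0 t N = weighted-cong (λ b → cong (λ l → 𝟙 (l ≟ 0)) (longer-bounded ≤-refl b))

weighted-exactly-suc : ∀ t k N → weighted t N (exactly (suc k) N) ≈ const 0ℤ
weighted-exactly-suc t k N = R.trans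
  (weighted-cong {ψ = λ _ → 0} (λ b → cong (λ l → 𝟙 (l ≟ suc k)) (longer-bounded ≤-refl b)))
  (weighted-0 t N)

exactly-0-split : ∀ t {j} N → j < suc N →
  weighted t (suc N) (exactly 0 j) ≈ weighted t N (exactly 0 j)
exactly-0-split t {j} N j< with t ∣? suc N
... | yes t∣ = weighted-multiple t∣ _
... | no  t∤ = R.trans (weighted-split t∤ _) (R.trans
  (R.+-congˡ (R.trans (R.*-congˡ (R.trans
    (weighted-cong {ψ = λ _ → 0} (λ {μ} _ → exactly-∷-0 μ j<)) (weighted-0 t (suc N))))
    (R.zeroʳ _)))
  (R.+-identityʳ _))

exactly-suc-split : ∀ {t} k {j} N → t ∤ suc N → j < suc N → weighted t (suc N) (exactly (suc k) j) ≈
  weighted t N (exactly (suc k) j) ⊕ q^ suc N ⊛ weighted t (suc N) (exactly k j)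
exactly-suc-split k N t∤ j< = R.trans (weighted-split t∤ _)
  (R.+-congˡ (R.*-congˡ (weighted-cong (λ {μ} _ → exactly-∷-suc k μ j<))))

-- Having no part above `j` is the same as being bounded by `j`, whatever larger bound was imposed.
weighted-exactly-0′ : ∀ t i j → weighted t (i + j) (exactly 0 j) ≈ regulars t j
weighted-exactly-0′ t zero    j = weighted-exactly-0 t j
weighted-exactly-0′ t (suc i) j =
  R.trans (exactly-0-split t (i + j) (s≤s (m≤n+m j i))) (weighted-exactly-0′ t i j)

hooks₃ : ℕ → ℕ → Series
hooks₃ t N = weighted t N (hooks 3)

-- Nonnegative series and the geometric series

record Nonneg (f : Series) : Set where
  constructor nonneg
  field coeff≥0 : ∀ n → 0ℤ ℤ.≤ f n
open Nonneg

Nonneg-resp-≈ : ∀ {f g} → f ≈ g → Nonneg g → Nonneg f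
Nonneg-resp-≈ eq g≥0 .coeff≥0 n = subst (0ℤ ℤ.≤_) (sym (coeff≡ eq n)) (coeff≥0 g≥0 n)

0≤* : ∀ {a b} → 0ℤ ℤ.≤ a → 0ℤ ℤ.≤ b → 0ℤ ℤ.≤ a ℤ.* b
0≤* {a} {b} p q = ℤ.≤-trans (ℤ.≤-reflexive (sym (ℤ.*-zeroʳ a)))
  (ℤ.*-monoˡ-≤-nonNeg a {{ℤ.nonNegative p}} q)

infixl 6 _⊕⁺_
infixl 7 _⊛⁺_

opaque
  unfolding _⊛_

  _⊕⁺_ : ∀ {f g} → Nonneg f → Nonneg g → Nonneg (f ⊕ g)
  (f≥0 ⊕⁺ g≥0) .coeff≥0 n = ℤ.+-mono-≤ (coeff≥0 f≥0 n) (coeff≥0 g≥0 n)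

  _⊛⁺_ : ∀ {f g} → Nonneg f → Nonneg g → Nonneg (f ⊛ g)
  (f≥0 ⊛⁺ g≥0) .coeff≥0 zero    = 0≤* (coeff≥0 f≥0 0) (coeff≥0 g≥0 0)
  (f≥0 ⊛⁺ g≥0) .coeff≥0 (suc n) = ℤ.+-mono-≤ (0≤* (coeff≥0 f≥0 0) (coeff≥0 g≥0 (suc n)))
    (coeff≥0 (nonneg (λ k → coeff≥0 f≥0 (suc k)) ⊛⁺ g≥0) n)

const-nonneg : ∀ c → Nonneg (const (pos c))
const-nonneg c .coeff≥0 zero    = ℤ.+≤+ z≤n
const-nonneg c .coeff≥0 (suc n) = ℤ.+≤+ z≤n

q-nonneg : Nonneg q
q-nonneg .coeff≥0 zero          = ℤ.+≤+ z≤n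
q-nonneg .coeff≥0 (suc zero)    = ℤ.+≤+ z≤n
q-nonneg .coeff≥0 (suc (suc n)) = ℤ.+≤+ z≤n

q⁺ : ∀ m → Nonneg (q^ m)
q⁺ zero    = const-nonneg 1
q⁺ (suc m) = q-nonneg ⊛⁺ q⁺ m

-- 1/(1 − q^m) for m > 0.
u : ℕ → Series
u m n = if does (m ∣? n) then 1ℤ else 0ℤ

u⁺ : ∀ m → Nonneg (u m)
u⁺ m .coeff≥0 n with does (m ∣? n)
... | true  = ℤ.+≤+ z≤n
... | false = ℤ.+≤+ z≤n

u-rec : ∀ m .{{_ : NonZero m}} → u m ≈ const 1ℤ ⊕ q^ m ⊛ u m
u-rec m .coeff≡ n with n <? m
... | yes n<m = trans (base n n<m)
  (sym (trans (coeff-⊕ _ _ n)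
    (trans (cong (λ s → const 1ℤ n ℤ.+ s) (q^-⊛-< m (u m) n<m)) (ℤ.+-identityʳ _))))
  where
  base : ∀ n → n < m → u m n ≡ const 1ℤ n
  base zero    _   = cong (if_then 1ℤ else 0ℤ) (dec-true (m ∣? 0) (m ∣0))
  base (suc n) n<m = cong (if_then 1ℤ else 0ℤ) (dec-false (m ∣? suc n) (>⇒∤ n<m))
... | no n≮m with k , refl ← m≤n⇒∃[o]m+o≡n (≮⇒≥ n≮m) = trans
  (cong (if_then 1ℤ else 0ℤ)
    (does-⇔ (mk⇔ (λ d → ∣m+n∣m⇒∣n d ∣-refl) (∣m∣n⇒∣m+n ∣-refl)) (m ∣? (m + k)) (m ∣? k)))
  (sym (trans (coeff-⊕ _ _ (m + k))
    (trans (cong₂ ℤ._+_ (const-+-0 m k) (q^-⊛-+ m (u m) k)) (ℤ.+-identityˡ _))))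
  where
  const-+-0 : ∀ m .{{_ : NonZero m}} k → const 1ℤ (m + k) ≡ 0ℤ
  const-+-0 (suc m) k = refl

-- Since 1 = `u m` - q^m · `u m`, multiplying `X` by 1 gives `u m` · (X - q^m X), which is `u m` ·
-- Y.
solve-u : ∀ m .{{_ : NonZero m}} {X Y} → X ≈ Y ⊕ q^ m ⊛ X → X ≈ u m ⊛ Y
solve-u m {X} {Y} eq = begin
  X                                              ≈⟨ step₁ X (q^ m) (u m) ⟩
  ((const 1ℤ ⊕ q^ m ⊛ u m) ⊕ ⊝ (q^ m ⊛ u m)) ⊛ X
    ≈⟨ R.*-congʳ (R.+-congʳ (u-rec m)) ⟨
  (u m ⊕ ⊝ (q^ m ⊛ u m)) ⊛ X                     ≈⟨ step₂ X (q^ m) (u m) ⟩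
  u m ⊛ (X ⊕ ⊝ (q^ m ⊛ X))                       ≈⟨ R.*-congˡ (R.+-congʳ eq) ⟩
  u m ⊛ ((Y ⊕ q^ m ⊛ X) ⊕ ⊝ (q^ m ⊛ X))          ≈⟨ step₃ X Y (q^ m) (u m) ⟩
  u m ⊛ Y                                        ∎
  where
  open ≈R
  step₁ : ∀ x z u → x ≈ ((const 1ℤ ⊕ z ⊛ u) ⊕ ⊝ (z ⊛ u)) ⊛ x
  step₁ = solve 3 (λ x z u → x := ((con 1ℤ :+ z :* u) :+ :- (z :* u)) :* x) R.refl
  step₂ : ∀ x z u → (u ⊕ ⊝ (z ⊛ u)) ⊛ x ≈ u ⊛ (x ⊕ ⊝ (z ⊛ x))
  step₂ = solve 3 (λ x z u → (u :+ :- (z :* u)) :* x := u :* (x :+ :- (z :* x))) R.refl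
  step₃ : ∀ x y z u → u ⊛ ((y ⊕ z ⊛ x) ⊕ ⊝ (z ⊛ x)) ≈ u ⊛ y
  step₃ = solve 4 (λ x y z u → u :* ((y :+ z :* x) :+ :- (z :* x)) := u :* y) R.refl

u-inverse : ∀ m .{{_ : NonZero m}} → (const 1ℤ ⊕ ⊝ (q^ m)) ⊛ u m ≈ const 1ℤ
u-inverse m = R.trans (s₁ (q^ m) (u m)) (R.trans (R.+-congʳ (u-rec m)) (s₂ (q^ m) (u m)))
  where
  s₁ : ∀ z u → (const 1ℤ ⊕ ⊝ z) ⊛ u ≈ u ⊕ ⊝ (z ⊛ u)
  s₁ = solve 2 (λ z u → (con 1ℤ :+ :- z) :* u := u :+ :- (z :* u)) R.refl
  s₂ : ∀ z u → (const 1ℤ ⊕ z ⊛ u) ⊕ ⊝ (z ⊛ u) ≈ const 1ℤ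
  s₂ = solve 2 (λ z u → (con 1ℤ :+ z :* u) :+ :- (z :* u) := con 1ℤ) R.refl

regulars-0 : ∀ t → regulars t 0 ≈ const 1ℤ
regulars-0 t = weighted-zero t _

regulars-multiple : ∀ {t N} → t ∣ suc N → regulars t (suc N) ≈ regulars t N
regulars-multiple t∣ = weighted-multiple t∣ _

regulars-suc : ∀ {t N} → t ∤ suc N → regulars t (suc N) ≈ u (suc N) ⊛ regulars t N
regulars-suc {N = N} t∤ = solve-u (suc N) (weighted-split t∤ _)

hooks₃-0 : ∀ t → hooks₃ t 0 ≈ const 0ℤ
hooks₃-0 t = weighted-zero t _

hooks₃-multiple : ∀ {t N} → t ∣ suc N → hooks₃ t (suc N) ≈ hooks₃ t N
hooks₃-multiple t∣ = weighted-multiple t∣ _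

hooks₃-∷ : ∀ {t N} (φ : List ℕ → ℕ) → t ∤ suc N → (∀ μ → hooks 3 (suc N ∷ μ) ≡ φ μ + hooks 3 μ) →
           hooks₃ t (suc N) ≈ u (suc N) ⊛ (hooks₃ t N ⊕ q^ suc N ⊛ weighted t (suc N) φ)
hooks₃-∷ {t} {N} φ t∤ eq = solve-u (suc N) (R.trans (weighted-split t∤ (hooks 3))
  (R.trans (R.+-congˡ (R.*-congˡ (R.trans (weighted-cong (λ {μ} _ → eq μ))
      (weighted-+ t (suc N) φ (hooks 3)))))
    (s (hooks₃ t N) (q^ suc N) _ _)))
  where
  s : ∀ h z x y → h ⊕ z ⊛ (x ⊕ y) ≈ (h ⊕ z ⊛ x) ⊕ z ⊛ y
  s = solve 4 (λ h z x y → h :+ z :* (x :+ y) := (h :+ z :* x) :+ z :* y) R.refl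

-- Under the bound `suc N`, two parts above `N` both equal `suc N`; all others are bounded by `N`.
weighted-exactly-2 : ∀ {t} N → t ∤ suc N →
  weighted t (suc N) (exactly 2 N) ≈ q^ suc N ⊛ (q^ suc N ⊛ regulars t N)
weighted-exactly-2 {t} N t∤ = begin
  weighted t (suc N) (exactly 2 N)
    ≈⟨ exactly-suc-split 1 N t∤ ≤-refl ⟩
  weighted t N (exactly 2 N) ⊕ Q ⊛ weighted t (suc N) (exactly 1 N)
    ≈⟨ R.+-cong (weighted-exactly-suc t 1 N) (R.*-congˡ (exactly-suc-split 0 N t∤ ≤-refl)) ⟩
  const 0ℤ ⊕ Q ⊛ (weighted t N (exactly 1 N) ⊕ Q ⊛ weighted t (suc N) (exactly 0 N))
    ≈⟨ R.+-identityˡ _ ⟩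
  Q ⊛ (weighted t N (exactly 1 N) ⊕ Q ⊛ weighted t (suc N) (exactly 0 N))
    ≈⟨ R.*-congˡ (R.+-cong (weighted-exactly-suc t 0 N) (R.*-congˡ (weighted-exactly-0′ t 1 N))) ⟩
  Q ⊛ (const 0ℤ ⊕ Q ⊛ regulars t N)
    ≈⟨ R.*-congˡ (R.+-identityˡ _) ⟩
  Q ⊛ (Q ⊛ regulars t N) ∎
  where
  open ≈R
  Q : Series
  Q = q^ suc N

-- The single part above `N` is `1 + N` or `2 + N`. The first case is left unevaluated because it
-- depends on whether `t` divides `1 + N`; the next two lemmas settle it.
weighted-exactly-1 : ∀ {t} N → t ∤ 2 + N → weighted t (2 + N) (exactly 1 N) ≈
  weighted t (1 + N) (exactly 1 N) ⊕ q^ (2 + N) ⊛ regulars t N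
weighted-exactly-1 {t} N t∤ = R.trans (exactly-suc-split 0 (suc N) t∤ (s≤s (n≤1+n N)))
  (R.+-congˡ (R.*-congˡ (weighted-exactly-0′ t 2 N)))

weighted-exactly-1-multiple : ∀ {t} N → t ∣ 1 + N → weighted t (1 + N) (exactly 1 N) ≈ const 0ℤ
weighted-exactly-1-multiple {t} N t∣ = R.trans (weighted-multiple t∣ _) (weighted-exactly-suc t 0 N)

weighted-exactly-1-split : ∀ {t} N → t ∤ 1 + N →
  weighted t (1 + N) (exactly 1 N) ≈ q^ (1 + N) ⊛ regulars t N
weighted-exactly-1-split {t} N t∤ = R.trans (exactly-suc-split 0 N t∤ ≤-refl)
  (R.trans (R.+-cong (weighted-exactly-suc t 0 N) (R.*-congˡ (weighted-exactly-0′ t 1 N)))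
    (R.+-identityˡ _))

-- A column has one hook of length 3 as soon as it has three boxes. This is the base case for t = 2;
-- for t = 3 the first block also contains the part 2.
hooks₃-1 : ∀ {t} → t ∤ 1 → hooks₃ t 1 ≈ u 1 ⊛ q^ 3
hooks₃-1 {t} t∤ = begin
  hooks₃ t 1                                            ≈⟨ hooks₃-∷ (exactly 2 0) t∤ hooks3-1 ⟩
  u 1 ⊛ (hooks₃ t 0 ⊕ q^ 1 ⊛ weighted t 1 (exactly 2 0))
    ≈⟨ R.*-congˡ (R.+-cong (hooks₃-0 t) (R.*-congˡ (R.trans (weighted-exactly-2 0 t∤)
         (R.*-congˡ (R.*-congˡ (regulars-0 t)))))) ⟩
  u 1 ⊛ (const 0ℤ ⊕ q^ 1 ⊛ (q^ 1 ⊛ (q^ 1 ⊛ const 1ℤ)))    ≈⟨ s (u 1) q ⟩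
  u 1 ⊛ q^ 3                                            ∎
  where
  open ≈R
  s : ∀ u q → u ⊛ (const 0ℤ ⊕ q ^ 1 ⊛ (q ^ 1 ⊛ (q ^ 1 ⊛ const 1ℤ))) ≈ u ⊛ q ^ 3
  s = solve 2 (λ u q → u :* (con 0ℤ :+ q :^ 1 :* (q :^ 1 :* (q :^ 1 :* con 1ℤ))) := u :* q :^ 3) R.refl

hooks₃-2 : ∀ {t} → t ∤ 1 → t ∤ 2 → hooks₃ t 2 ≈
  u 2 ⊛ (u 1 ⊛ q^ 3 ⊕ (q^ 3 ⊕ q^ 4 ⊕ q^ 6 ⊛ u 1))
hooks₃-2 {t} t∤1 t∤2 = begin
  hooks₃ t 2
    ≈⟨ hooks₃-∷ (λ μ → exactly 1 0 μ + exactly 2 1 μ) t∤2 hooks3-2 ⟩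
  u 2 ⊛ (hooks₃ t 1 ⊕ q^ 2 ⊛ weighted t 2 (λ μ → exactly 1 0 μ + exactly 2 1 μ))
    ≈⟨ R.*-congˡ (R.+-cong (hooks₃-1 t∤1) (R.*-congˡ (R.trans (weighted-+ t 2 _ _)
         (R.+-cong (R.trans (weighted-exactly-1 0 t∤2) (R.+-cong
                     (R.trans (weighted-exactly-1-split 0 t∤1) (R.*-congˡ (regulars-0 t)))
                     (R.*-congˡ (regulars-0 t))))
                   (R.trans (weighted-exactly-2 1 t∤2) (R.*-congˡ (R.*-congˡ
                     (R.trans (regulars-suc t∤1) (R.*-congˡ (regulars-0 t))))))))) ) ⟩
  u 2 ⊛ (u 1 ⊛ q^ 3 ⊕ q^ 2 ⊛ ((q^ 1 ⊛ const 1ℤ ⊕ q^ 2 ⊛ const 1ℤ)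
    ⊕ q^ 2 ⊛ (q^ 2 ⊛ (u 1 ⊛ const 1ℤ))))
    ≈⟨ s (u 1) (u 2) q ⟩
  u 2 ⊛ (u 1 ⊛ q^ 3 ⊕ (q^ 3 ⊕ q^ 4 ⊕ q^ 6 ⊛ u 1)) ∎
  where
  open ≈R
  s : ∀ u₁ u₂ q → _
  s = solve 3 (λ u₁ u₂ q →
    u₂ :* (u₁ :* q :^ 3 :+ q :^ 2 :* ((q :^ 1 :* con 1ℤ :+ q :^ 2 :* con 1ℤ)
      :+ q :^ 2 :* (q :^ 2 :* (u₁ :* con 1ℤ))))
    := u₂ :* (u₁ :* q :^ 3 :+ (q :^ 3 :+ q :^ 4 :+ q :^ 6 :* u₁))) R.refl

hooks₃-3+ : ∀ {t} m → t ∤ 3 + m → hooks₃ t (3 + m) ≈ u (3 + m) ⊛ (hooks₃ t (2 + m) ⊕ q^ (3 + m) ⊛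
  (regulars t m ⊕ ((weighted t (2 + m) (exactly 1 (1 + m)) ⊕ q^ (3 + m) ⊛ regulars t (1 + m))
    ⊕ q^ (3 + m) ⊛ (q^ (3 + m) ⊛ regulars t (2 + m)))))
hooks₃-3+ {t} m t∤ = R.trans
  (hooks₃-∷ (λ μ → exactly 0 m μ + (exactly 1 (1 + m) μ + exactly 2 (2 + m) μ)) t∤ (hooks3-3+ m))
  (R.*-congˡ (R.+-congˡ (R.*-congˡ (R.trans (weighted-+ t (3 + m) (exactly 0 m) _)
    (R.+-cong (weighted-exactly-0′ t 3 m) (R.trans (weighted-+ t (3 + m) (exactly 1 (1 + m)) _)
      (R.+-cong (weighted-exactly-1 (1 + m) t∤) (weighted-exactly-2 (2 + m) t∤))))))))

-- Closed forms of the hook series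

∤-+ : ∀ r {t n} .{{_ : NonZero r}} → r < t → t ∣ n → t ∤ r + n
∤-+ r {t} {n} r<t t∣n t∣ = >⇒∤ r<t (∣m+n∣m⇒∣n (subst (t ∣_) (+-comm r n) t∣) t∣n)

-- The ring solver treats every `u m` as an indeterminate. Its relation to `q` enters only through
-- factors (1 - q^m) · `u m`, written `:d` in the solver's terms, which this lemma inserts and
-- removes.
u-cancel : ∀ m .{{_ : NonZero m}} X → X ⊛ ((const 1ℤ ⊕ ⊝ (q^ m)) ⊛ u m) ≈ X
u-cancel m X = R.trans (R.*-congˡ (u-inverse m)) (R.*-identityʳ X)

-- Rewrites products with fewer parts as polynomial multiples of the largest one, which can then be
-- factored out.
regulars-pred : ∀ {t N} → t ∤ suc N →
  regulars t N ≈ (const 1ℤ ⊕ ⊝ (q^ suc N)) ⊛ regulars t (suc N)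
regulars-pred {t} {N} t∤ = begin
  regulars t N
    ≈⟨ u-cancel (suc N) _ ⟨
  regulars t N ⊛ ((const 1ℤ ⊕ ⊝ (q^ suc N)) ⊛ u (suc N))
    ≈⟨ s (regulars t N) (const 1ℤ ⊕ ⊝ (q^ suc N)) (u (suc N)) ⟩
  (const 1ℤ ⊕ ⊝ (q^ suc N)) ⊛ (u (suc N) ⊛ regulars t N)
    ≈⟨ R.*-congˡ (regulars-suc t∤) ⟨
  (const 1ℤ ⊕ ⊝ (q^ suc N)) ⊛ regulars t (suc N) ∎
  where
  open ≈R
  s : ∀ c d u → c ⊛ (d ⊛ u) ≈ d ⊛ (u ⊛ c)
  s = solve 3 (λ c d u → c :* (d :* u) := d :* (u :* c)) R.refl

-- F_t is the limit of hooks₃ t N / regulars t N as N grows.  For N = k t + t,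
-- with z = q^(k t), tail_t z is the part of F_t due to the parts beyond N.
F₂ : Series
F₂ = q^ 3 ⊛ u 2 ⊕ (q^ 6 ⊕ ⊝ q^ 4) ⊛ u 4 ⊕ q^ 3 ⊛ u 6

tail₂ : Series → Series
tail₂ z = z ⊛ (q^ 3 ⊛ u 2 ⊕ z ⊛ ((q^ 6 ⊕ ⊝ q^ 4) ⊛ u 4 ⊕ z ⊛ (q^ 9 ⊛ u 6)))

F₃ : Series
F₃ = q^ 3 ⊕ (q^ 4 ⊕ q^ 5) ⊛ u 3 ⊕ (q^ 4 ⊕ ⊝ q^ 6 ⊕ q^ 8) ⊛ u 6
   ⊕ (q^ 3 ⊕ ⊝ q^ 4 ⊕ ⊝ q^ 5 ⊕ q^ 6) ⊛ u 9

tail₃ : Series → Series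
tail₃ z = z ⊛ ((q^ 4 ⊕ q^ 5) ⊛ u 3 ⊕ z ⊛ ((q^ 8 ⊕ ⊝ q^ 6 ⊕ q^ 10) ⊛ u 6
        ⊕ z ⊛ ((q^ 12 ⊕ ⊝ q^ 13 ⊕ ⊝ q^ 14 ⊕ q^ 15) ⊛ u 9)))

private
  :d : ∀ {n} → ℕ → Polynomial n → Polynomial n → Polynomial n
  :d m q u = (con 1ℤ :+ :- q :^ m) :* u

F₂-start : F₂ ≈ q^ 3 ⊕ tail₂ (const 1ℤ)
F₂-start = R.trans (s q (u 2) (u 4) (u 6)) (R.+-congʳ (u-cancel 6 _))
  where
  s : ∀ q u₂ u₄ u₆ → _
  s = solve 4 (λ q u₂ u₄ u₆ → let z = con 1ℤ in
    q :^ 3 :* u₂ :+ (q :^ 6 :+ :- q :^ 4) :* u₄ :+ q :^ 3 :* u₆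
    := q :^ 3 :* :d 6 q u₆
       :+ z :* (q :^ 3 :* u₂ :+ z :* ((q :^ 6 :+ :- q :^ 4) :* u₄ :+ z :* (q :^ 9 :* u₆)))) R.refl

-- With z = q^(2k) and Q = q^3 z, the part 3 + 2k contributes Q(1 - qz + Q + Q²) relative to
-- `regulars`. The added cubic is this product sorted by powers of z.
tail₂-step : ∀ z → tail₂ z ≈ tail₂ (q^ 2 ⊛ z) ⊕
  (z ⊛ q^ 3 ⊕ z ^ 2 ⊛ (q^ 6 ⊕ ⊝ q^ 4) ⊕ z ^ 3 ⊛ q^ 9)
tail₂-step z = R.trans (s q (u 2) (u 4) (u 6) z)
  (R.+-congˡ (R.+-cong (R.+-cong (u-cancel 2 _) (u-cancel 4 _)) (u-cancel 6 _)))
  where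
  s : ∀ q u₂ u₄ u₆ z → _
  s = solve 5 (λ q u₂ u₄ u₆ z →
    let T = λ z → z :* (q :^ 3 :* u₂ :+ z :* ((q :^ 6 :+ :- q :^ 4) :* u₄ :+ z :* (q :^ 9 :* u₆))) in
    T z := T (q :^ 2 :* z) :+ (z :* q :^ 3 :* :d 2 q u₂
             :+ z :^ 2 :* (q :^ 6 :+ :- q :^ 4) :* :d 4 q u₄ :+ z :^ 3 :* q :^ 9 :* :d 6 q u₆)) R.refl

-- The parts 1 and 2 contribute 2q^3 - q^5 + q^6. Split as q^3 + q^4 + p, it merges with
-- `tail₃ (const 1ℤ)`, since q^4 + q^10 · `u 6` = q^4 · `u 6` and p + q^9 p · `u 9` = p · `u 9`.
F₃-start : F₃ ≈ (q^ 3 ⊕ q^ 4 ⊕ (q^ 3 ⊕ ⊝ q^ 4 ⊕ ⊝ q^ 5 ⊕ q^ 6)) ⊕ tail₃ (const 1ℤ)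
F₃-start = R.trans (s q (u 3) (u 6) (u 9))
  (R.+-congʳ (R.+-cong (R.+-congˡ (u-cancel 6 _)) (u-cancel 9 _)))
  where
  s : ∀ q u₃ u₆ u₉ → _
  s = solve 4 (λ q u₃ u₆ u₉ → let z = con 1ℤ in
    q :^ 3 :+ (q :^ 4 :+ q :^ 5) :* u₃ :+ (q :^ 4 :+ :- q :^ 6 :+ q :^ 8) :* u₆
      :+ (q :^ 3 :+ :- q :^ 4 :+ :- q :^ 5 :+ q :^ 6) :* u₉
    := (q :^ 3 :+ q :^ 4 :* :d 6 q u₆ :+ (q :^ 3 :+ :- q :^ 4 :+ :- q :^ 5 :+ q :^ 6) :* :d 9 q u₉)
      :+ z :* ((q :^ 4 :+ q :^ 5) :* u₃ :+ z :* ((q :^ 8 :+ :- q :^ 6 :+ q :^ 10) :* u₆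
        :+ z :* ((q :^ 12 :+ :- q :^ 13 :+ :- q :^ 14 :+ q :^ 15) :* u₉)))) R.refl

-- With z = q^(3k), Q₄ = q^4 z and Q₅ = q^5 z, the parts 4 + 3k and 5 + 3k contribute Q₄(1 - q²z +
-- Q₄ + Q₄²) and Q₅((1 - Q₄)(1 + Q₄ + Q₅) + Q₅²). The cubic is their sum.
tail₃-step : ∀ z → tail₃ z ≈ tail₃ (q^ 3 ⊛ z) ⊕
  (z ⊛ (q^ 4 ⊕ q^ 5) ⊕ z ^ 2 ⊛ (q^ 8 ⊕ ⊝ q^ 6 ⊕ q^ 10)
    ⊕ z ^ 3 ⊛ (q^ 12 ⊕ ⊝ q^ 13 ⊕ ⊝ q^ 14 ⊕ q^ 15))
tail₃-step z = R.trans (s q (u 3) (u 6) (u 9) z)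
  (R.+-congˡ (R.+-cong (R.+-cong (u-cancel 3 _) (u-cancel 6 _)) (u-cancel 9 _)))
  where
  s : ∀ q u₃ u₆ u₉ z → _
  s = solve 5 (λ q u₃ u₆ u₉ z →
    let a = q :^ 4 :+ q :^ 5
        b = q :^ 8 :+ :- q :^ 6 :+ q :^ 10
        c = q :^ 12 :+ :- q :^ 13 :+ :- q :^ 14 :+ q :^ 15
        T = λ z → z :* (a :* u₃ :+ z :* (b :* u₆ :+ z :* (c :* u₉))) in
    T z := T (q :^ 3 :* z) :+ (z :* a :* :d 3 q u₃ :+ z :^ 2 :* b :* :d 6 q u₆
             :+ z :^ 3 :* c :* :d 9 q u₉)) R.refl

-- The contributions telescope: raising the bound from 2 + 2k to 4 + 2k admits only the part 3 + 2k,
-- whose share is `tail₂ z ⊕ ⊝ tail₂ (q^ 2 ⊛ z)`.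
hooks₃-2-closed : ∀ k →
  hooks₃ 2 (2 + k * 2) ≈ regulars 2 (2 + k * 2) ⊛ (F₂ ⊕ ⊝ tail₂ (q^ (k * 2)))
hooks₃-2-closed zero = begin
  hooks₃ 2 2                     ≈⟨ hooks₃-multiple (divides-refl 1) ⟩
  hooks₃ 2 1                     ≈⟨ hooks₃-1 (∤-+ 1 (s≤s (s≤s z≤n)) (divides-refl 0)) ⟩
  u 1 ⊛ q^ 3                     ≈⟨ s (u 1) (q^ 3) (tail₂ (const 1ℤ)) ⟩
  u 1 ⊛ const 1ℤ ⊛ ((q^ 3 ⊕ tail₂ (const 1ℤ)) ⊕ ⊝ tail₂ (const 1ℤ))
    ≈⟨ R.*-cong (R.trans (regulars-multiple (divides-refl 1))
         (R.trans (regulars-suc (∤-+ 1 (s≤s (s≤s z≤n)) (divides-refl 0))) (R.*-congˡ (regulars-0 2))))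
         (R.+-congʳ F₂-start) ⟨
  regulars 2 2 ⊛ (F₂ ⊕ ⊝ tail₂ (const 1ℤ)) ∎
  where
  open ≈R
  s : ∀ u x t → u ⊛ x ≈ u ⊛ const 1ℤ ⊛ ((x ⊕ t) ⊕ ⊝ t)
  s = solve 3 (λ u x t → u :* x := u :* con 1ℤ :* ((x :+ t) :+ :- t)) R.refl
hooks₃-2-closed (suc k) = begin
  hooks₃ 2 (4 + k * 2)           ≈⟨ hooks₃-multiple (divides-refl (2 + k)) ⟩
  hooks₃ 2 (3 + k * 2)           ≈⟨ hooks₃-3+ (k * 2) 3∤ ⟩
  y ⊛ (hooks₃ 2 (2 + k * 2) ⊕ Q ⊛ (regulars 2 (k * 2)
    ⊕ ((weighted 2 (2 + k * 2) (exactly 1 (1 + k * 2)) ⊕ Q ⊛ regulars 2 (1 + k * 2)) ⊕ Q ⊛ (Q ⊛ c))))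
    ≈⟨ R.*-congˡ (R.+-cong (hooks₃-2-closed k) (R.*-congˡ (R.+-cong
         (R.trans (regulars-pred (∤-+ 1 (s≤s (s≤s z≤n)) (divides-refl k))) (R.*-congˡ c′))
         (R.+-congʳ (R.+-cong (weighted-exactly-1-multiple (1 + k * 2) (divides-refl (suc k)))
           (R.*-congˡ c′)))))) ⟩
  y ⊛ (c ⊛ (F₂ ⊕ ⊝ tail₂ z) ⊕ Q ⊛ ((const 1ℤ ⊕ ⊝ (q ⊛ z)) ⊛ c
    ⊕ ((const 0ℤ ⊕ Q ⊛ c) ⊕ Q ⊛ (Q ⊛ c))))
    ≈⟨ R.*-congˡ (R.+-congʳ (R.*-congˡ (R.+-congˡ (R.-‿cong (tail₂-step z))))) ⟩
  y ⊛ (c ⊛ (F₂ ⊕ ⊝ (tail₂ (q^ 2 ⊛ z) ⊕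
    (z ⊛ q^ 3 ⊕ z ^ 2 ⊛ (q^ 6 ⊕ ⊝ q^ 4) ⊕ z ^ 3 ⊛ q^ 9))) ⊕ Q ⊛ ((const 1ℤ ⊕ ⊝ (q ⊛ z)) ⊛ c
    ⊕ ((const 0ℤ ⊕ Q ⊛ c) ⊕ Q ⊛ (Q ⊛ c))))
    ≈⟨ s q z y c F₂ (tail₂ (q^ 2 ⊛ z)) ⟩
  (y ⊛ c) ⊛ (F₂ ⊕ ⊝ tail₂ (q^ 2 ⊛ z))
    ≈⟨ R.*-cong (R.trans (regulars-multiple (divides-refl (2 + k))) (regulars-suc 3∤))
         (R.+-congˡ (R.-‿cong (tail₂-cong (^-homo-* q 2 (k * 2))))) ⟨
  regulars 2 (4 + k * 2) ⊛ (F₂ ⊕ ⊝ tail₂ (q^ (2 + k * 2))) ∎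
  where
  open ≈R
  z c y Q : Series
  z = q^ (k * 2)
  c = regulars 2 (2 + k * 2)
  y = u (3 + k * 2)
  Q = q^ (3 + k * 2)
  c′ : regulars 2 (1 + k * 2) ≈ c
  c′ = R.sym (regulars-multiple (divides-refl (suc k)))
  3∤ : 2 ∤ 3 + k * 2
  3∤ = ∤-+ 1 (s≤s (s≤s z≤n)) (divides-refl (suc k))
  tail₂-cong : ∀ {x y} → x ≈ y → tail₂ x ≈ tail₂ y
  tail₂-cong e = R.*-cong e (R.+-congˡ (R.*-cong e (R.+-congˡ (R.*-congʳ e))))
  s : ∀ q z y c F T → _
  -- `q^ (3 + k * 2)` unfolds to this product, so the solver sees how `Q` depends on `q` and `z`.
  s = solve 6 (λ q z y c F T → let Q = q :* (q :* (q :* z)) in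
    y :* (c :* (F :+ :- (T :+ (z :* q :^ 3 :+ z :^ 2 :* (q :^ 6 :+ :- q :^ 4) :+ z :^ 3 :* q :^ 9)))
      :+ Q :* ((con 1ℤ :+ :- (q :* z)) :* c :+ ((con 0ℤ :+ Q :* c) :+ Q :* (Q :* c))))
    := (y :* c) :* (F :+ :- T)) R.refl

hooks₃-3-closed : ∀ k →
  hooks₃ 3 (3 + k * 3) ≈ regulars 3 (3 + k * 3) ⊛ (F₃ ⊕ ⊝ tail₃ (q^ (k * 3)))
hooks₃-3-closed zero = begin
  hooks₃ 3 3                     ≈⟨ hooks₃-multiple (divides-refl 1) ⟩
  hooks₃ 3 2                     ≈⟨ hooks₃-2 3∤1 3∤2 ⟩
  u 2 ⊛ (u 1 ⊛ q^ 3 ⊕ (q^ 3 ⊕ q^ 4 ⊕ q^ 6 ⊛ u 1))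
    ≈⟨ R.*-congˡ (R.+-congˡ (R.+-congʳ (u-cancel 1 _))) ⟨
  u 2 ⊛ (u 1 ⊛ q^ 3 ⊕ ((q^ 3 ⊕ q^ 4) ⊛ ((const 1ℤ ⊕ ⊝ (q^ 1)) ⊛ u 1) ⊕ q^ 6 ⊛ u 1))
    ≈⟨ s (u 1) (u 2) q (tail₃ (const 1ℤ)) ⟩
  u 2 ⊛ (u 1 ⊛ const 1ℤ) ⊛
    (((q^ 3 ⊕ q^ 4 ⊕ (q^ 3 ⊕ ⊝ q^ 4 ⊕ ⊝ q^ 5 ⊕ q^ 6)) ⊕ tail₃ (const 1ℤ)) ⊕ ⊝ tail₃ (const 1ℤ))
    ≈⟨ R.*-cong (R.trans (regulars-multiple (divides-refl 1)) (R.trans (regulars-suc 3∤2)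
         (R.*-congˡ (R.trans (regulars-suc 3∤1) (R.*-congˡ (regulars-0 3))))))
         (R.+-congʳ F₃-start) ⟨
  regulars 3 3 ⊛ (F₃ ⊕ ⊝ tail₃ (const 1ℤ)) ∎
  where
  open ≈R
  3∤1 : 3 ∤ 1
  3∤1 = >⇒∤ (s≤s (s≤s z≤n))
  3∤2 : 3 ∤ 2
  3∤2 = >⇒∤ (s≤s (s≤s (s≤s z≤n)))
  s : ∀ u₁ u₂ q t → _
  s = solve 4 (λ u₁ u₂ q t →
    u₂ :* (u₁ :* q :^ 3 :+ ((q :^ 3 :+ q :^ 4) :* :d 1 q u₁ :+ q :^ 6 :* u₁))
    := u₂ :* (u₁ :* con 1ℤ) :*
       (((q :^ 3 :+ q :^ 4 :+ (q :^ 3 :+ :- q :^ 4 :+ :- q :^ 5 :+ q :^ 6)) :+ t) :+ :- t)) R.refl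
hooks₃-3-closed (suc k) = begin
  hooks₃ 3 (6 + k * 3)           ≈⟨ hooks₃-multiple (divides-refl (2 + k)) ⟩
  hooks₃ 3 (5 + k * 3)           ≈⟨ hooks₃-3+ (2 + k * 3) 3∤5 ⟩
  y₂ ⊛ (hooks₃ 3 (4 + k * 3) ⊕ Q₅ ⊛ (regulars 3 (2 + k * 3)
    ⊕ ((weighted 3 (4 + k * 3) (exactly 1 (3 + k * 3)) ⊕ Q₅ ⊛ c) ⊕ Q₅ ⊛ (Q₅ ⊛ regulars 3 (4 + k * 3)))))
    ≈⟨ R.*-congˡ (R.+-cong fourth (R.*-congˡ (R.+-cong c′
         (R.+-cong (R.+-congʳ (weighted-exactly-1-split (3 + k * 3) 3∤4))
           (R.*-congˡ (R.*-congˡ (regulars-suc 3∤4))))))) ⟩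
  y₂ ⊛ (y₁ ⊛ c ⊛ (F₃ ⊕ ⊝ tail₃ z ⊕ Q₄ ⊛ (const 1ℤ ⊕ ⊝ (q ⊛ (q ⊛ z)) ⊕ Q₄ ⊕ Q₄ ^ 2))
    ⊕ Q₅ ⊛ (c ⊕ ((Q₄ ⊛ c ⊕ Q₅ ⊛ c) ⊕ Q₅ ⊛ (Q₅ ⊛ (y₁ ⊛ c)))))
    -- The bare `c` in the share of 5 + 3k become multiples of `y₁ ⊛ c`, the common factor of all
    -- summands.
    ≈⟨ R.*-congˡ (R.+-congˡ (R.*-congˡ (R.+-cong c″ (R.+-congʳ (R.+-cong (R.*-congˡ c″) (R.*-congˡ c″)))))) ⟩
  y₂ ⊛ (y₁ ⊛ c ⊛ (F₃ ⊕ ⊝ tail₃ z ⊕ Q₄ ⊛ (const 1ℤ ⊕ ⊝ (q ⊛ (q ⊛ z)) ⊕ Q₄ ⊕ Q₄ ^ 2))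
    ⊕ Q₅ ⊛ (D ⊕ ((Q₄ ⊛ D ⊕ Q₅ ⊛ D) ⊕ Q₅ ⊛ (Q₅ ⊛ (y₁ ⊛ c)))))
    ≈⟨ R.*-congˡ (R.+-congʳ (R.*-congˡ (R.+-congʳ (R.+-congˡ (R.-‿cong (tail₃-step z)))))) ⟩
  y₂ ⊛ (y₁ ⊛ c ⊛ (F₃ ⊕ ⊝ (tail₃ (q^ 3 ⊛ z) ⊕ (z ⊛ (q^ 4 ⊕ q^ 5) ⊕ z ^ 2 ⊛ (q^ 8 ⊕ ⊝ q^ 6 ⊕ q^ 10)
         ⊕ z ^ 3 ⊛ (q^ 12 ⊕ ⊝ q^ 13 ⊕ ⊝ q^ 14 ⊕ q^ 15)))
       ⊕ Q₄ ⊛ (const 1ℤ ⊕ ⊝ (q ⊛ (q ⊛ z)) ⊕ Q₄ ⊕ Q₄ ^ 2))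
    ⊕ Q₅ ⊛ (D ⊕ ((Q₄ ⊛ D ⊕ Q₅ ⊛ D) ⊕ Q₅ ⊛ (Q₅ ⊛ (y₁ ⊛ c)))))
    ≈⟨ s₂ q z y₁ y₂ c F₃ (tail₃ (q^ 3 ⊛ z)) ⟩
  (y₂ ⊛ (y₁ ⊛ c)) ⊛ (F₃ ⊕ ⊝ tail₃ (q^ 3 ⊛ z))
    ≈⟨ R.*-cong (R.trans (regulars-multiple (divides-refl (2 + k)))
         (R.trans (regulars-suc 3∤5) (R.*-congˡ (regulars-suc 3∤4))))
         (R.+-congˡ (R.-‿cong (tail₃-cong (^-homo-* q 3 (k * 3))))) ⟨
  regulars 3 (6 + k * 3) ⊛ (F₃ ⊕ ⊝ tail₃ (q^ (3 + k * 3))) ∎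
  where
  open ≈R
  z c y₁ y₂ Q₄ Q₅ D : Series
  z = q^ (k * 3)
  c = regulars 3 (3 + k * 3)
  y₁ = u (4 + k * 3)
  y₂ = u (5 + k * 3)
  Q₄ = q^ (4 + k * 3)
  Q₅ = q^ (5 + k * 3)
  D = (const 1ℤ ⊕ ⊝ Q₄) ⊛ (y₁ ⊛ c)
  3∤4 : 3 ∤ 4 + k * 3
  3∤4 = ∤-+ 1 (s≤s (s≤s z≤n)) (divides-refl (suc k))
  3∤5 : 3 ∤ 5 + k * 3
  3∤5 = ∤-+ 2 ≤-refl (divides-refl (suc k))
  c′ : regulars 3 (2 + k * 3) ≈ c
  c′ = R.sym (regulars-multiple (divides-refl (suc k)))
  c″ : c ≈ D
  c″ = R.trans (regulars-pred 3∤4) (R.*-congˡ (regulars-suc 3∤4))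
  tail₃-cong : ∀ {x y} → x ≈ y → tail₃ x ≈ tail₃ y
  tail₃-cong e = R.*-cong e (R.+-congˡ (R.*-cong e (R.+-congˡ (R.*-congʳ e))))
  s₁ : ∀ q z y c F T → _
  s₁ = solve 6 (λ q z y c F T → let Q₂ = q :* (q :* z); Q₄ = q :* (q :* Q₂) in
    y :* (c :* (F :+ :- T) :+ Q₄ :* ((con 1ℤ :+ :- Q₂) :* c :+ ((con 0ℤ :+ Q₄ :* c) :+ Q₄ :* (Q₄ :* c))))
    := y :* c :* (F :+ :- T :+ Q₄ :* (con 1ℤ :+ :- Q₂ :+ Q₄ :+ Q₄ :^ 2))) R.refl
  s₂ : ∀ q z y₁ y₂ c F T → _
  s₂ = solve 7 (λ q z y₁ y₂ c F T →
    let Q₂ = q :* (q :* z); Q₄ = q :* (q :* Q₂); Q₅ = q :* Q₄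
        D = (con 1ℤ :+ :- Q₄) :* (y₁ :* c) in
    y₂ :* (y₁ :* c :* (F :+ :- (T :+ (z :* (q :^ 4 :+ q :^ 5)
         :+ z :^ 2 :* (q :^ 8 :+ :- q :^ 6 :+ q :^ 10)
         :+ z :^ 3 :* (q :^ 12 :+ :- q :^ 13 :+ :- q :^ 14 :+ q :^ 15)))
       :+ Q₄ :* (con 1ℤ :+ :- Q₂ :+ Q₄ :+ Q₄ :^ 2))
     :+ Q₅ :* (D :+ ((Q₄ :* D :+ Q₅ :* D) :+ Q₅ :* (Q₅ :* (y₁ :* c)))))
    := (y₂ :* (y₁ :* c)) :* (F :+ :- T)) R.refl
  fourth : hooks₃ 3 (4 + k * 3) ≈
    y₁ ⊛ c ⊛ (F₃ ⊕ ⊝ tail₃ z ⊕ Q₄ ⊛ (const 1ℤ ⊕ ⊝ (q ⊛ (q ⊛ z)) ⊕ Q₄ ⊕ Q₄ ^ 2))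
  fourth = begin
    hooks₃ 3 (4 + k * 3) ≈⟨ hooks₃-3+ (1 + k * 3) 3∤4 ⟩
    y₁ ⊛ (hooks₃ 3 (3 + k * 3) ⊕ Q₄ ⊛ (regulars 3 (1 + k * 3)
      ⊕ ((weighted 3 (3 + k * 3) (exactly 1 (2 + k * 3)) ⊕ Q₄ ⊛ regulars 3 (2 + k * 3)) ⊕ Q₄ ⊛ (Q₄ ⊛ c))))
      ≈⟨ R.*-congˡ (R.+-cong (hooks₃-3-closed k) (R.*-congˡ (R.+-cong
         (R.trans (regulars-pred (∤-+ 2 ≤-refl (divides-refl k))) (R.*-congˡ c′))
         (R.+-congʳ (R.+-cong (weighted-exactly-1-multiple (2 + k * 3) (divides-refl (suc k)))
           (R.*-congˡ c′)))))) ⟩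
    y₁ ⊛ (c ⊛ (F₃ ⊕ ⊝ tail₃ z) ⊕ Q₄ ⊛ ((const 1ℤ ⊕ ⊝ (q ⊛ (q ⊛ z))) ⊛ c
      ⊕ ((const 0ℤ ⊕ Q₄ ⊛ c) ⊕ Q₄ ⊛ (Q₄ ⊛ c))))
      ≈⟨ s₁ q z y₁ c F₃ (tail₃ z) ⟩
    y₁ ⊛ c ⊛ (F₃ ⊕ ⊝ tail₃ z ⊕ Q₄ ⊛ (const 1ℤ ⊕ ⊝ (q ⊛ (q ⊛ z)) ⊕ Q₄ ⊕ Q₄ ^ 2)) ∎

-- Nonnegativity of M and G

-- Here `p` is the quotient (1 - q^M)/(1 - q^m); the instances bring sums over a common denominator.
u-ratio : ∀ m M .{{_ : NonZero m}} .{{_ : NonZero M}} {p} →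
          (const 1ℤ ⊕ ⊝ (q^ m)) ⊛ p ≈ const 1ℤ ⊕ ⊝ (q^ M) → u m ≈ p ⊛ u M
u-ratio m M {p} eq = begin
  u m                                             ≈⟨ u-cancel M (u m) ⟨
  u m ⊛ ((const 1ℤ ⊕ ⊝ (q^ M)) ⊛ u M)             ≈⟨ R.*-congˡ (R.*-congʳ eq) ⟨
  u m ⊛ ((const 1ℤ ⊕ ⊝ (q^ m)) ⊛ p ⊛ u M)         ≈⟨ s (u m) (const 1ℤ ⊕ ⊝ (q^ m)) p (u M) ⟩
  p ⊛ u M ⊛ ((const 1ℤ ⊕ ⊝ (q^ m)) ⊛ u m)         ≈⟨ u-cancel m (p ⊛ u M) ⟩
  p ⊛ u M                                         ∎
  where
  open ≈R
  s : ∀ u d p v → u ⊛ (d ⊛ p ⊛ v) ≈ p ⊛ v ⊛ (d ⊛ u)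
  s = solve 4 (λ u d p v → u :* (d :* p :* v) := p :* v :* (d :* u)) R.refl

u₃-u₉ : u 3 ≈ (const 1ℤ ⊕ q^ 3 ⊕ q^ 6) ⊛ u 9
u₃-u₉ = u-ratio 3 9 (solve 1 (λ q → (con 1ℤ :+ :- q :^ 3) :* (con 1ℤ :+ q :^ 3 :+ q :^ 6)
  := con 1ℤ :+ :- q :^ 9) R.refl q)

u₁-u₃ : u 1 ≈ (const 1ℤ ⊕ q ⊕ q^ 2) ⊛ u 3
u₁-u₃ = u-ratio 1 3 (solve 1 (λ q → (con 1ℤ :+ :- q :^ 1) :* (con 1ℤ :+ q :+ q :^ 2)
  := con 1ℤ :+ :- q :^ 3) R.refl q)

u₁-u₄ : u 1 ≈ (const 1ℤ ⊕ q ⊕ q^ 2 ⊕ q^ 3) ⊛ u 4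
u₁-u₄ = u-ratio 1 4 (solve 1 (λ q → (con 1ℤ :+ :- q :^ 1) :* (con 1ℤ :+ q :+ q :^ 2 :+ q :^ 3)
  := con 1ℤ :+ :- q :^ 4) R.refl q)

u₂-u₄ : u 2 ≈ (const 1ℤ ⊕ q^ 2) ⊛ u 4
u₂-u₄ = u-ratio 2 4 (solve 1 (λ q → (con 1ℤ :+ :- q :^ 2) :* (con 1ℤ :+ q :^ 2)
  := con 1ℤ :+ :- q :^ 4) R.refl q)

u₆-u₁₈ : u 6 ≈ (const 1ℤ ⊕ q^ 6 ⊕ q^ 12) ⊛ u 18
u₆-u₁₈ = u-ratio 6 18 (solve 1 (λ q → (con 1ℤ :+ :- q :^ 6) :* (con 1ℤ :+ q :^ 6 :+ q :^ 12)
  := con 1ℤ :+ :- q :^ 18) R.refl q)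

u₉-u₁₈ : u 9 ≈ (const 1ℤ ⊕ q^ 9) ⊛ u 18
u₉-u₁₈ = u-ratio 9 18 (solve 1 (λ q → (con 1ℤ :+ :- q :^ 9) :* (con 1ℤ :+ q :^ 9)
  := con 1ℤ :+ :- q :^ 18) R.refl q)

u₃-u₁₈ : u 3 ≈ (const 1ℤ ⊕ q^ 3 ⊕ q^ 6) ⊛ ((const 1ℤ ⊕ q^ 9) ⊛ u 18)
u₃-u₁₈ = R.trans u₃-u₉ (R.*-congˡ u₉-u₁₈)

M : Series
M = u 2 ⊛ u 4 ⊛ F₃

-- The negative terms of F₃ sit in q^4 - q^6 = q^4(1 - q²) and q^3 - q^4 - q^5 + q^6 = (q^3 - q^4)(1
-- - q²), and `u 2` cancels 1 - q². The remaining -q^4 · `u 9` · `u 4` is a term of the expansion of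
-- q^4 · `u 4` · `u 3` · `u 2`.
M-nonneg : Nonneg M
M-nonneg = Nonneg-resp-≈ (begin
  M
    ≈⟨ s₁ q (u 2) (u 3) (u 4) (u 6) (u 9) ⟩
  rest ⊕ q^ 4 ⊛ u 4 ⊛ (u 3 ⊛ u 2)
    ⊕ (q^ 4 ⊛ u 6 ⊛ u 4 ⊕ (q^ 3 ⊕ ⊝ q^ 4) ⊛ u 9 ⊛ u 4) ⊛ ((const 1ℤ ⊕ ⊝ (q^ 2)) ⊛ u 2)
    ≈⟨ R.+-cong (R.+-congˡ (R.*-congˡ (R.*-cong u₃-u₉ (u-rec 2)))) (u-cancel 2 _) ⟩
  rest ⊕ q^ 4 ⊛ u 4 ⊛ ((const 1ℤ ⊕ q^ 3 ⊕ q^ 6) ⊛ u 9 ⊛ (const 1ℤ ⊕ q^ 2 ⊛ u 2))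
    ⊕ (q^ 4 ⊛ u 6 ⊛ u 4 ⊕ (q^ 3 ⊕ ⊝ q^ 4) ⊛ u 9 ⊛ u 4)
    ≈⟨ s₂ q (u 2) (u 4) (u 6) (u 9) rest ⟩
  rest ⊕ (q^ 3 ⊕ q^ 7 ⊕ q^ 10 ⊕ (q^ 6 ⊕ q^ 9 ⊕ q^ 12) ⊛ u 2) ⊛ u 9 ⊛ u 4 ⊕ q^ 4 ⊛ u 6 ⊛ u 4 ∎)
  ((q⁺ 3 ⊛⁺ u⁺ 2 ⊕⁺ q⁺ 5 ⊛⁺ u⁺ 3 ⊛⁺ u⁺ 2 ⊕⁺ q⁺ 8 ⊛⁺ u⁺ 6 ⊛⁺ u⁺ 2) ⊛⁺ u⁺ 4
    ⊕⁺ (q⁺ 3 ⊕⁺ q⁺ 7 ⊕⁺ q⁺ 10 ⊕⁺ (q⁺ 6 ⊕⁺ q⁺ 9 ⊕⁺ q⁺ 12) ⊛⁺ u⁺ 2) ⊛⁺ u⁺ 9 ⊛⁺ u⁺ 4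
    ⊕⁺ q⁺ 4 ⊛⁺ u⁺ 6 ⊛⁺ u⁺ 4)
  where
  open ≈R
  rest : Series
  rest = (q^ 3 ⊛ u 2 ⊕ q^ 5 ⊛ u 3 ⊛ u 2 ⊕ q^ 8 ⊛ u 6 ⊛ u 2) ⊛ u 4
  s₁ : ∀ q u₂ u₃ u₄ u₆ u₉ → _
  s₁ = solve 6 (λ q u₂ u₃ u₄ u₆ u₉ →
    u₂ :* u₄ :* (q :^ 3 :+ (q :^ 4 :+ q :^ 5) :* u₃ :+ (q :^ 4 :+ :- q :^ 6 :+ q :^ 8) :* u₆
      :+ (q :^ 3 :+ :- q :^ 4 :+ :- q :^ 5 :+ q :^ 6) :* u₉)
    := (q :^ 3 :* u₂ :+ q :^ 5 :* u₃ :* u₂ :+ q :^ 8 :* u₆ :* u₂) :* u₄ :+ q :^ 4 :* u₄ :* (u₃ :* u₂)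
      :+ (q :^ 4 :* u₆ :* u₄ :+ (q :^ 3 :+ :- q :^ 4) :* u₉ :* u₄) :* :d 2 q u₂) R.refl
  s₂ : ∀ q u₂ u₄ u₆ u₉ rest → _
  s₂ = solve 6 (λ q u₂ u₄ u₆ u₉ rest →
    rest :+ q :^ 4 :* u₄ :* ((con 1ℤ :+ q :^ 3 :+ q :^ 6) :* u₉ :* (con 1ℤ :+ q :^ 2 :* u₂))
      :+ (q :^ 4 :* u₆ :* u₄ :+ (q :^ 3 :+ :- q :^ 4) :* u₉ :* u₄)
    := rest :+ (q :^ 3 :+ q :^ 7 :+ q :^ 10 :+ (q :^ 6 :+ q :^ 9 :+ q :^ 12) :* u₂) :* u₉ :* u₄
      :+ q :^ 4 :* u₆ :* u₄) R.refl

horner : List ℕ → Series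
horner []       = const 0ℤ
horner (c ∷ cs) = const (pos c) ⊕ q ⊛ horner cs

horner-nonneg : ∀ cs → Nonneg (horner cs)
horner-nonneg []       = const-nonneg 0
horner-nonneg (c ∷ cs) = const-nonneg c ⊕⁺ q-nonneg ⊛⁺ horner-nonneg cs

-- The coefficients of (1 − q³)(1 − q⁴)²(1 − q¹⁸) G, in increasing degree.
numerator : List ℕ
numerator = 0 ∷ 0 ∷ 0 ∷ 0 ∷ 2 ∷ 3 ∷ 1 ∷ 4 ∷ 3 ∷ 3 ∷ 7 ∷ 5 ∷ 6 ∷ 5 ∷ 5 ∷ 3 ∷ 5 ∷ 5 ∷ 5 ∷ 6 ∷ 5 ∷ 5
  ∷ 4 ∷ 2 ∷ 3 ∷ 0 ∷ 2 ∷ 1 ∷ []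

G : Series
G = u 1 ⊛ (M ⊕ ⊝ (u 3 ⊛ F₂))

-- To reach one denominator, `u 1` is expanded differently in the two terms: over `u 3` next to F₃,
-- over `u 4` next to F₂. The 18 is the least common multiple of 6 and 9.
G-closed : G ≈ horner numerator ⊛ (u 3 ⊛ u 4 ⊛ u 4 ⊛ u 18)
G-closed = begin
  G ≈⟨ s₀ (u 1) (u 2) (u 3) (u 4) F₂ F₃ ⟩
  u 1 ⊛ u 2 ⊛ u 4 ⊛ F₃ ⊕ ⊝ (u 1 ⊛ u 3 ⊛ F₂)
    ≈⟨ R.+-cong (R.*-cong (R.*-congʳ (R.*-cong u₁-u₃ u₂-u₄)) F₃-over)
         (R.-‿cong (R.*-cong (R.*-congʳ u₁-u₄) F₂-over)) ⟩
  _ ≈⟨ s q (u 3) (u 4) (u 18) ⟩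
  horner numerator ⊛ (u 3 ⊛ u 4 ⊛ u 4 ⊛ u 18) ∎
  where
  open ≈R
  :f₃ :f₂ :p₃ : ∀ {n} → Polynomial n → Polynomial n
  :p₃ q = con 1ℤ :+ q :^ 3 :+ q :^ 6
  :f₃ q = q :^ 3 :* (con 1ℤ :+ :- q :^ 18) :+ (q :^ 4 :+ q :^ 5) :* (:p₃ q :* (con 1ℤ :+ q :^ 9))
    :+ (q :^ 4 :+ :- q :^ 6 :+ q :^ 8) :* (con 1ℤ :+ q :^ 6 :+ q :^ 12)
    :+ (q :^ 3 :+ :- q :^ 4 :+ :- q :^ 5 :+ q :^ 6) :* (con 1ℤ :+ q :^ 9)
  :f₂ q = (q :^ 3 :* (con 1ℤ :+ q :^ 2) :+ (q :^ 6 :+ :- q :^ 4)) :* (con 1ℤ :+ :- q :^ 18)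
    :+ q :^ 3 :* (con 1ℤ :+ q :^ 6 :+ q :^ 12) :* (con 1ℤ :+ :- q :^ 4)
  :horner : ∀ {n} → Polynomial n → List ℕ → Polynomial n
  :horner q []       = con 0ℤ
  :horner q (c ∷ cs) = con (pos c) :+ q :* :horner q cs
  F₃-over : F₃ ≈ _ ⊛ u 18
  F₃-over = R.trans
    (R.+-cong (R.+-cong (R.+-cong (R.sym (u-cancel 18 (q^ 3))) (R.*-congˡ u₃-u₁₈))
      (R.*-congˡ u₆-u₁₈)) (R.*-congˡ u₉-u₁₈))
    (solve 2 (λ q w → q :^ 3 :* :d 18 q w :+ (q :^ 4 :+ q :^ 5) :* (:p₃ q :* ((con 1ℤ :+ q :^ 9) :* w))
       :+ (q :^ 4 :+ :- q :^ 6 :+ q :^ 8) :* ((con 1ℤ :+ q :^ 6 :+ q :^ 12) :* w)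
       :+ (q :^ 3 :+ :- q :^ 4 :+ :- q :^ 5 :+ q :^ 6) :* ((con 1ℤ :+ q :^ 9) :* w)
       := :f₃ q :* w) R.refl q (u 18))
  F₂-over : F₂ ≈ _ ⊛ (u 4 ⊛ u 18)
  F₂-over = R.trans
    (R.+-cong (R.trans (R.+-congʳ (R.*-congˡ u₂-u₄)) (R.sym (u-cancel 18 _)))
      (R.trans (R.*-congˡ u₆-u₁₈) (R.sym (u-cancel 4 _))))
    (solve 3 (λ q v w → (q :^ 3 :* ((con 1ℤ :+ q :^ 2) :* v) :+ (q :^ 6 :+ :- q :^ 4) :* v) :* :d 18 q w
       :+ q :^ 3 :* ((con 1ℤ :+ q :^ 6 :+ q :^ 12) :* w) :* :d 4 q v
       := :f₂ q :* (v :* w)) R.refl q (u 4) (u 18))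
  s₀ : ∀ u₁ u₂ u₃ u₄ f₂ f₃ → _
  s₀ = solve 6 (λ u₁ u₂ u₃ u₄ f₂ f₃ → u₁ :* (u₂ :* u₄ :* f₃ :+ :- (u₃ :* f₂))
    := u₁ :* u₂ :* u₄ :* f₃ :+ :- (u₁ :* u₃ :* f₂)) R.refl
  s : ∀ q u₃ u₄ u₁₈ → _
  s = solve 4 (λ q u₃ u₄ u₁₈ →
    (con 1ℤ :+ q :+ q :^ 2) :* u₃ :* ((con 1ℤ :+ q :^ 2) :* u₄) :* u₄ :* (:f₃ q :* u₁₈)
      :+ :- ((con 1ℤ :+ q :+ q :^ 2 :+ q :^ 3) :* u₄ :* u₃ :* (:f₂ q :* (u₄ :* u₁₈)))
    := :horner q numerator :* (u₃ :* u₄ :* u₄ :* u₁₈)) R.refl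

G-nonneg : Nonneg G
G-nonneg = Nonneg-resp-≈ G-closed (horner-nonneg numerator ⊛⁺ (u⁺ 3 ⊛⁺ u⁺ 4 ⊛⁺ u⁺ 4 ⊛⁺ u⁺ 18))

-- Comparison of the products

-- The difference `u m` - `u (suc m)` has numerator q^m - q^(m+1) = q^m(1 - q), and `u 1` cancels 1
-- - q.
u-gap : ∀ m .{{_ : NonZero m}} → u 1 ⊛ (u m ⊕ ⊝ u (suc m)) ≈ q^ m ⊛ u m ⊛ u (suc m)
u-gap m = begin
  u 1 ⊛ (u m ⊕ ⊝ u (suc m))
    ≈⟨ R.*-congˡ (R.+-cong (u-cancel (suc m) _) (R.-‿cong (u-cancel m _))) ⟨
  u 1 ⊛ (u m ⊛ ((const 1ℤ ⊕ ⊝ (q ⊛ q^ m)) ⊛ u (suc m))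
    ⊕ ⊝ (u (suc m) ⊛ ((const 1ℤ ⊕ ⊝ (q^ m)) ⊛ u m)))
    ≈⟨ s q (q^ m) (u 1) (u m) (u (suc m)) ⟩
  q^ m ⊛ u m ⊛ u (suc m) ⊛ ((const 1ℤ ⊕ ⊝ (q^ 1)) ⊛ u 1)
    ≈⟨ u-cancel 1 _ ⟩
  q^ m ⊛ u m ⊛ u (suc m) ∎
  where
  open ≈R
  s : ∀ q z u₁ v w → _
  s = solve 5 (λ q z u₁ v w →
    u₁ :* (v :* ((con 1ℤ :+ :- (q :* z)) :* w) :+ :- (w :* ((con 1ℤ :+ :- z) :* v)))
    := z :* v :* w :* :d 1 q u₁) R.refl

-- a, e and o are products of u p over the parts p ≤ 6 + 6k congruent to ±1, ±2 and 3
-- modulo 6 respectively, leaving out p = 1, 2, 3, 4.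
record Factors (k : ℕ) : Set where
  field
    a e o       : Series
    a-nonneg    : Nonneg a
    e-nonneg    : Nonneg e
    o-nonneg    : Nonneg o
    gap         : Nonneg (u 1 ⊛ (e ⊕ ⊝ o))
    regulars-3  : regulars 3 (6 + k * 6) ≈ u 1 ⊛ a ⊛ (u 2 ⊛ u 4 ⊛ e)
    regulars-2  : regulars 2 (6 + k * 6) ≈ u 1 ⊛ a ⊛ (u 3 ⊛ o)

regulars-3-step : ∀ {N} → 3 ∣ N → regulars 3 (3 + N) ≈ u (2 + N) ⊛ (u (1 + N) ⊛ regulars 3 N)
regulars-3-step 3∣N = R.trans (regulars-multiple (∣m∣n⇒∣m+n ∣-refl 3∣N))
  (R.trans (regulars-suc (∤-+ 2 ≤-refl 3∣N)) (R.*-congˡ (regulars-suc (∤-+ 1 (s≤s (s≤s z≤n)) 3∣N))))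

regulars-2-step : ∀ {N} → 2 ∣ N → regulars 2 (2 + N) ≈ u (1 + N) ⊛ regulars 2 N
regulars-2-step 2∣N = R.trans (regulars-multiple (∣m∣n⇒∣m+n ∣-refl 2∣N)) (regulars-suc (∤-+ 1 ≤-refl 2∣N))

regulars-3-block : ∀ {N} → 3 ∣ N →
  regulars 3 (6 + N) ≈ u (5 + N) ⊛ (u (4 + N) ⊛ (u (2 + N) ⊛ (u (1 + N) ⊛ regulars 3 N)))
regulars-3-block 3∣N = R.trans (regulars-3-step (∣m∣n⇒∣m+n ∣-refl 3∣N))
  (R.*-congˡ (R.*-congˡ (regulars-3-step 3∣N)))

regulars-2-block : ∀ {N} → 2 ∣ N →
  regulars 2 (6 + N) ≈ u (5 + N) ⊛ (u (3 + N) ⊛ (u (1 + N) ⊛ regulars 2 N))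
regulars-2-block 2∣N = R.trans (regulars-2-step (∣m∣n⇒∣m+n (divides-refl 2) 2∣N))
  (R.*-congˡ (R.trans (regulars-2-step (∣m∣n⇒∣m+n ∣-refl 2∣N)) (R.*-congˡ (regulars-2-step 2∣N))))

factors : ∀ k → Factors k
factors zero = record
  { a = u 5 ; e = const 1ℤ ; o = const 1ℤ
  ; a-nonneg = u⁺ 5 ; e-nonneg = const-nonneg 1 ; o-nonneg = const-nonneg 1
  ; gap = Nonneg-resp-≈ (R.trans (R.*-congˡ (R.-‿inverseʳ _)) (R.zeroʳ _)) (const-nonneg 0)
  ; regulars-3 = R.trans (regulars-3-block (divides-refl 0))
      (R.trans (R.*-congˡ (R.*-congˡ (R.*-congˡ (R.*-congˡ (regulars-0 3)))))
        (s₃ (u 1) (u 2) (u 4) (u 5)))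
  ; regulars-2 = R.trans (regulars-2-block (divides-refl 0))
      (R.trans (R.*-congˡ (R.*-congˡ (R.*-congˡ (regulars-0 2)))) (s₂ (u 1) (u 3) (u 5)))
  }
  where
  s₃ : ∀ u₁ u₂ u₄ u₅ → _
  s₃ = solve 4 (λ u₁ u₂ u₄ u₅ → u₅ :* (u₄ :* (u₂ :* (u₁ :* con 1ℤ)))
    := u₁ :* u₅ :* (u₂ :* u₄ :* con 1ℤ)) R.refl
  s₂ : ∀ u₁ u₃ u₅ → _
  s₂ = solve 3 (λ u₁ u₃ u₅ → u₅ :* (u₃ :* (u₁ :* con 1ℤ)) := u₁ :* u₅ :* (u₃ :* con 1ℤ)) R.refl
factors (suc k) = record
  { a = a ⊛ u (1 + L) ⊛ u (5 + L) ; e = e ⊛ u (2 + L) ⊛ u (4 + L) ; o = o ⊛ u (3 + L)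
  ; a-nonneg = a-nonneg ⊛⁺ u⁺ (1 + L) ⊛⁺ u⁺ (5 + L)
  ; e-nonneg = e-nonneg ⊛⁺ u⁺ (2 + L) ⊛⁺ u⁺ (4 + L)
  ; o-nonneg = o-nonneg ⊛⁺ u⁺ (3 + L)
  ; gap = Nonneg-resp-≈ gap-step
      (gap ⊛⁺ u⁺ (2 + L) ⊛⁺ u⁺ (4 + L)
        ⊕⁺ o-nonneg ⊛⁺ (q⁺ (2 + L) ⊛⁺ u⁺ (2 + L) ⊛⁺ u⁺ (3 + L))
        ⊕⁺ o-nonneg ⊛⁺ (u⁺ 1 ⊛⁺ u⁺ (2 + L) ⊛⁺ (q⁺ (4 + L) ⊛⁺ u⁺ (4 + L))))
  ; regulars-3 = R.trans (regulars-3-block (∣n⇒∣m*n (suc k) (divides-refl 2)))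
      (R.trans (R.*-congˡ (R.*-congˡ (R.*-congˡ (R.*-congˡ regulars-3))))
        (s₃ (u 1) a (u 2) (u 4) e (u (1 + L)) (u (2 + L)) (u (4 + L)) (u (5 + L))))
  ; regulars-2 = R.trans (regulars-2-block (∣n⇒∣m*n (suc k) (divides-refl 3)))
      (R.trans (R.*-congˡ (R.*-congˡ (R.*-congˡ regulars-2)))
        (s₂ (u 1) a (u 3) o (u (1 + L)) (u (3 + L)) (u (5 + L))))
  }
  where
  open Factors (factors k)
  open ≈R
  L : ℕ
  L = 6 + k * 6
  s₃ : ∀ u₁ a u₂ u₄ e v₁ v₂ v₄ v₅ → _
  s₃ = solve 9 (λ u₁ a u₂ u₄ e v₁ v₂ v₄ v₅ →
    v₅ :* (v₄ :* (v₂ :* (v₁ :* (u₁ :* a :* (u₂ :* u₄ :* e)))))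
    := u₁ :* (a :* v₁ :* v₅) :* (u₂ :* u₄ :* (e :* v₂ :* v₄))) R.refl
  s₂ : ∀ u₁ a u₃ o v₁ v₃ v₅ → _
  s₂ = solve 7 (λ u₁ a u₃ o v₁ v₃ v₅ →
    v₅ :* (v₃ :* (v₁ :* (u₁ :* a :* (u₃ :* o))))
    := u₁ :* (a :* v₁ :* v₅) :* (u₃ :* (o :* v₃))) R.refl
  s₄ : ∀ u₁ e o v₂ v₃ v₄ → _
  s₄ = solve 6 (λ u₁ e o v₂ v₃ v₄ →
    u₁ :* (e :* v₂ :* v₄ :+ :- (o :* v₃))
    := u₁ :* (e :+ :- o) :* v₂ :* v₄ :+ o :* (u₁ :* (v₂ :* v₄ :+ :- v₃))) R.refl
  s₅ : ∀ u₁ o v₂ v₃ x → _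
  s₅ = solve 5 (λ u₁ o v₂ v₃ x → o :* (u₁ :* (v₂ :* (con 1ℤ :+ x) :+ :- v₃))
    := o :* (u₁ :* (v₂ :+ :- v₃)) :+ o :* (u₁ :* v₂ :* x)) R.refl
  -- Writing vᵢ for `u (i + L)`, the new difference is (e - o)v₂v₄ + o(v₂v₄ - v₃). Splitting v₄ = 1
  -- + q^(4+L)v₄ leaves v₂ - v₃, which is a case of `u-gap`.
  gap-step : u 1 ⊛ (e ⊛ u (2 + L) ⊛ u (4 + L) ⊕ ⊝ (o ⊛ u (3 + L))) ≈
    u 1 ⊛ (e ⊕ ⊝ o) ⊛ u (2 + L) ⊛ u (4 + L)
    ⊕ o ⊛ (q^ (2 + L) ⊛ u (2 + L) ⊛ u (3 + L))
    ⊕ o ⊛ (u 1 ⊛ u (2 + L) ⊛ (q^ (4 + L) ⊛ u (4 + L)))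
  gap-step = begin
    _ ≈⟨ s₄ (u 1) e o (u (2 + L)) (u (3 + L)) (u (4 + L)) ⟩
    E ⊕ o ⊛ (u 1 ⊛ (u (2 + L) ⊛ u (4 + L) ⊕ ⊝ u (3 + L)))
      ≈⟨ R.+-congˡ (R.*-congˡ (R.*-congˡ (R.+-congʳ (R.*-congˡ (u-rec (4 + L)))))) ⟩
    E ⊕ o ⊛ (u 1 ⊛ (u (2 + L) ⊛ (const 1ℤ ⊕ q^ (4 + L) ⊛ u (4 + L)) ⊕ ⊝ u (3 + L)))
      ≈⟨ R.+-congˡ (s₅ (u 1) o (u (2 + L)) (u (3 + L)) _) ⟩
    E ⊕ (o ⊛ (u 1 ⊛ (u (2 + L) ⊕ ⊝ u (3 + L))) ⊕ o ⊛ (u 1 ⊛ u (2 + L) ⊛ (q^ (4 + L) ⊛ u (4 + L))))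
      ≈⟨ R.+-assoc _ _ _ ⟨
    E ⊕ o ⊛ (u 1 ⊛ (u (2 + L) ⊕ ⊝ u (3 + L))) ⊕ o ⊛ (u 1 ⊛ u (2 + L) ⊛ (q^ (4 + L) ⊛ u (4 + L)))
      ≈⟨ R.+-congʳ (R.+-congˡ (R.*-congˡ (u-gap (2 + L)))) ⟩
    _ ∎
    where
    E : Series
    E = u 1 ⊛ (e ⊕ ⊝ o) ⊛ u (2 + L) ⊛ u (4 + L)

-- Comparison of the coefficients of q^n

excess : ∀ {k} → Factors k → Series
excess f = a ⊛ (u 1 ⊛ (e ⊕ ⊝ o) ⊛ M ⊕ o ⊛ G)
  where open Factors f

excess-nonneg : ∀ {k} (f : Factors k) → Nonneg (excess f)
excess-nonneg f = a-nonneg ⊛⁺ (gap ⊛⁺ M-nonneg ⊕⁺ o-nonneg ⊛⁺ G-nonneg)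
  where open Factors f

-- After both factorizations are inserted, this is a polynomial identity in nine independent
-- unknowns: u₁ · o · u₂u₄F₃ is subtracted and added back.
regulars-excess : ∀ {k} (f : Factors k) →
  regulars 3 (6 + k * 6) ⊛ F₃ ≈ regulars 2 (6 + k * 6) ⊛ F₂ ⊕ excess f
regulars-excess f = R.trans (R.*-congʳ regulars-3) (R.trans
  (solve 9 (λ u₁ u₂ u₃ u₄ a e o f₂ f₃ → u₁ :* a :* (u₂ :* u₄ :* e) :* f₃
     := u₁ :* a :* (u₃ :* o) :* f₂ :+ a :* (u₁ :* (e :+ :- o) :* (u₂ :* u₄ :* f₃)
        :+ o :* (u₁ :* (u₂ :* u₄ :* f₃ :+ :- (u₃ :* f₂))))) R.refl
     (u 1) (u 2) (u 3) (u 4) a e o F₂ F₃)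
  (R.+-congʳ (R.*-congʳ (R.sym regulars-2))))
  where open Factors f

drop-tail : ∀ {H C F T Y m} → H ≈ C ⊛ (F ⊕ ⊝ T) → T ≈ q^ m ⊛ Y → ∀ {n} → n < m → H n ≡ (C ⊛ F) n
drop-tail {H} {C} {F} {T} {Y} {m} eq eqT {n} n<m = trans (coeff≡ eq′ n)
  (trans (coeff-⊕ _ _ n) (trans (cong (λ s → (C ⊛ F) n ℤ.+ s) (q^-⊛-< m (⊝ (C ⊛ Y)) n<m))
    (ℤ.+-identityʳ _)))
  where
  s : ∀ c f z y → c ⊛ (f ⊕ ⊝ (z ⊛ y)) ≈ c ⊛ f ⊕ z ⊛ ⊝ (c ⊛ y)
  s = solve 4 (λ c f z y → c :* (f :+ :- (z :* y)) := c :* f :+ z :* :- (c :* y)) R.refl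
  eq′ : H ≈ C ⊛ F ⊕ q^ m ⊛ ⊝ (C ⊛ Y)
  eq′ = R.trans eq (R.trans (R.*-congˡ (R.+-congˡ (R.-‿cong eqT))) (s C F (q^ m) Y))

hooks₃-3-low : ∀ n → hooks₃ 3 (6 + n * 6) n ≡ (regulars 3 (6 + n * 6) ⊛ F₃) n
hooks₃-3-low n = subst (λ x → hooks₃ 3 (6 + x) n ≡ (regulars 3 (6 + x) ⊛ F₃) n) (*-assoc n 2 3)
  -- With k = 1 + 2n the bound 3 + 3k is 6 + 6n, and `tail₃` carries the factor q^(3 + 6n).
  (drop-tail {m = 3 + n * 2 * 3} (hooks₃-3-closed (1 + n * 2)) R.refl
    (s≤s (≤-trans (m≤m*n n 6) (≤-trans (≤-reflexive (sym (*-assoc n 2 3))) (m≤n+m _ 2)))))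

hooks₃-2-low : ∀ n → hooks₃ 2 (6 + n * 6) n ≡ (regulars 2 (6 + n * 6) ⊛ F₂) n
hooks₃-2-low n = subst (λ x → hooks₃ 2 (6 + x) n ≡ (regulars 2 (6 + x) ⊛ F₂) n) (*-assoc n 3 2)
  -- With k = 2 + 3n the bound 2 + 2k is again 6 + 6n, and `tail₂` carries the factor q^(4 + 6n).
  (drop-tail {m = 4 + n * 3 * 2} (hooks₃-2-closed (2 + n * 3)) R.refl
    (s≤s (≤-trans (m≤m*n n 6) (≤-trans (≤-reflexive (sym (*-assoc n 3 2))) (m≤n+m _ 3)))))

theorem1p3 : (n : ℕ) → b 3 3 n ≥ b 2 3 n
theorem1p3 n = ℤ.drop‿+≤+ (begin
  pos (b 2 3 n)                                       ≡⟨ weighted-b 2 3 n≤L ⟨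
  hooks₃ 2 L n                                        ≡⟨ hooks₃-2-low n ⟩
  (regulars 2 L ⊛ F₂) n                               ≡⟨ ℤ.+-identityʳ _ ⟨
  (regulars 2 L ⊛ F₂) n ℤ.+ 0ℤ
    ≤⟨ ℤ.+-monoʳ-≤ ((regulars 2 L ⊛ F₂) n) (coeff≥0 (excess-nonneg (factors n)) n) ⟩
  (regulars 2 L ⊛ F₂) n ℤ.+ excess (factors n) n      ≡⟨ coeff-⊕ _ _ n ⟨
  (regulars 2 L ⊛ F₂ ⊕ excess (factors n)) n          ≡⟨ coeff≡ (regulars-excess (factors n)) n ⟨
  (regulars 3 L ⊛ F₃) n                               ≡⟨ hooks₃-3-low n ⟨
  hooks₃ 3 L n                                        ≡⟨ weighted-b 3 3 n≤L ⟩
  pos (b 3 3 n)                                       ∎)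
  where
  open ℤ.≤-Reasoning
  -- A multiple of 6, so that the closed forms for t = 2 and t = 3 apply to the same bound.
  L : ℕ
  L = 6 + n * 6
  n≤L : n ≤ L
  n≤L = ≤-trans (m≤m*n n 6) (m≤n+m (n * 6) 6)
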